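{- For every integer $r\geq 4$, there exists a constant $c>0$ such that for every integer $n\ge 2$, $$R_{r}^{1,1,1}(n)\geq 2^{cn^{\lfloor r/2\rfloor-1}}.$$
   Context: An $r$-uniform hypergraph $H$ is semi-algebraic of complexity $(d,D,m)$ if there is an enumeration $v_1,\dots,v_N$ of its vertices, an assignment $v_i\mapsto p_i\in\mathbb{R}^d$ for $i\in[N]=\{1,\dots,N\}$, $m$ polynomials $f_1,\dots,f_m:(\mathbb{R}^d)^r\to\mathbb{R}$ of (total) degree at most $D$, and a function $\Phi:\{+,-,0\}^m\to\{\text{True},\text{False}\}$ such that for all $1\le i_1<\dots<i_r\le N$, the set $\{v_{i_1},\dots,v_{i_r}\}$ is an edge of $H$ if and only if $\Phi(\operatorname{sign}f_1(p_{i_1},\dots,p_{i_r}),\dots,\operatorname{sign}f_m(p_{i_1},\dots,p_{i_r}))=\text{True}$, where $\operatorname{sign}(x)\in\{+,-,0\}$ is the sign of $x$. The Ramsey number $R_r^{d,D,m}(n)$ is the smallest $N$ such that every $r$-uniform semi-algebraic hypergraph of complexity $(d,D,m)$ on $N$ vertices contains either a clique of size $n$ (a set of $n$ vertices all of whose $r$-element subsets are edges) or an independent set of size $n$ (a set of $n$ vertices none of whose $r$-element subsets is an edge). -}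

module Defs where

open import Algebra.Bundles using (CommutativeMonoid)
import Algebra.Properties.CommutativeSemigroup as CommutativeSemigroupProperties
import Algebra.Properties.Group as GroupProperties
import Algebra.Properties.Ring as RingProperties
open import Data.Bool.Base using (Bool; true)
open import Data.Fin.Base as Fin using (Fin)
open import Data.Fin.Permutation using (Permutation′; _⟨$⟩ʳ_)
open import Data.Fin.Subset using (Subset; _⊆_; ⁅_⁆; ⋃) renaming (∣_∣ to card)
open import Data.Integer.Base using (+_)
open import Data.List.Base as List using (List)
open import Data.List.Relation.Unary.All using (All)
open import Data.Nat.Base as ℕ using (ℕ; zero; suc; NonZero)
import Data.Nat.Properties as ℕ
open import Data.Product.Base using (_×_; _,_; ∃; ∃-syntax; proj₁; proj₂)
open import Data.Rational.Base as ℚ using (ℚ; 0ℚ; 1ℚ; ½; ∣_∣; Positive)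
import Data.Rational.Properties as ℚ
open import Data.Sum.Base using (_⊎_)
open import Data.Vec.Base using (Vec; lookup)
open import Data.Vec.Functional as Vector using (Vector)
open import Function.Base using (_∘_)
open import Function.Bundles using (_⇔_)
open import Relation.Binary.Core using (_Preserves_⟶_)
open import Relation.Binary.PropositionalEquality
open import Relation.Nullary using (¬_)

-- Real numbers: Cauchy sequences of rationals, compared up to ≈ℝ.

Cauchy : (ℕ → ℚ) → Set
Cauchy x = ∀ ε → 0ℚ ℚ.< ε →
  ∃[ k ] ∀ i j → k ℕ.≤ i → k ℕ.≤ j → ∣ x i ℚ.- x j ∣ ℚ.< ε

record ℝ : Set where
  constructor mkℝ
  field
    seq    : ℕ → ℚ
    cauchy : Cauchy seq

open ℝ public

infix 4 _<ℝ_ _≈ℝ_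

_<ℝ_ : ℝ → ℝ → Set
x <ℝ y = ∃[ ε ] (0ℚ ℚ.< ε × ∃[ k ] ∀ i → k ℕ.≤ i → seq x i ℚ.+ ε ℚ.≤ seq y i)

_≈ℝ_ : ℝ → ℝ → Set
x ≈ℝ y = ∀ ε → 0ℚ ℚ.< ε → ∃[ k ] ∀ i → k ℕ.≤ i → ∣ seq x i ℚ.- seq y i ∣ ℚ.< ε

fromℚ : ℚ → ℝ
fromℚ q = mkℝ (λ _ → q) λ ε 0<ε → 0 , λ _ _ _ _ →
  subst (ℚ._< ε) (sym (cong ∣_∣ (ℚ.+-inverseʳ q))) 0<ε

0ℝ 1ℝ : ℝ
0ℝ = fromℚ 0ℚ
1ℝ = fromℚ 1ℚ

fromℕ : ℕ → ℝ
fromℕ n = fromℚ (+ n ℚ./ 1)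

private
  open CommutativeSemigroupProperties
    (CommutativeMonoid.commutativeSemigroup ℚ.+-0-commutativeMonoid)
    using (interchange)
  open GroupProperties ℚ.+-0-group using (//-rightDividesˡ)
  open RingProperties ℚ.+-*-ring using (x[y-z]≈xy-xz; [y-z]x≈yx-zx)

  split : ∀ a b → a ≡ (a ℚ.- b) ℚ.+ b
  split a b = sym (//-rightDividesˡ b a)

  half-pos : ∀ {ε} → 0ℚ ℚ.< ε → 0ℚ ℚ.< ½ ℚ.* ε
  half-pos = ℚ.*-monoʳ-<-pos ½

  half+half : ∀ ε → ½ ℚ.* ε ℚ.+ ½ ℚ.* ε ≡ ε
  half+half ε = trans (sym (ℚ.*-distribʳ-+ ε ½ ½)) (ℚ.*-identityˡ ε)

  -- abstract: normalising sums and products of reals should not unfold these.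
  abstract
    +-cauchy : ∀ x y → Cauchy x → Cauchy y → Cauchy (λ i → x i ℚ.+ y i)
    +-cauchy x y cx cy ε 0<ε
      with k , p ← cx (½ ℚ.* ε) (half-pos 0<ε)
         | l , q ← cy (½ ℚ.* ε) (half-pos 0<ε)
      = k ℕ.⊔ l , λ i j ki kj → begin-strict
        ∣ (x i ℚ.+ y i) ℚ.- (x j ℚ.+ y j) ∣
          ≡⟨ cong ∣_∣ (rearrange (x i) (y i) (x j) (y j)) ⟩
        ∣ (x i ℚ.- x j) ℚ.+ (y i ℚ.- y j) ∣
          ≤⟨ ℚ.∣p+q∣≤∣p∣+∣q∣ (x i ℚ.- x j) (y i ℚ.- y j) ⟩
        ∣ x i ℚ.- x j ∣ ℚ.+ ∣ y i ℚ.- y j ∣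
          <⟨ ℚ.+-mono-<
               (p i j (ℕ.m⊔n≤o⇒m≤o k l ki) (ℕ.m⊔n≤o⇒m≤o k l kj))
               (q i j (ℕ.m⊔n≤o⇒n≤o k l ki) (ℕ.m⊔n≤o⇒n≤o k l kj)) ⟩
        ½ ℚ.* ε ℚ.+ ½ ℚ.* ε
          ≡⟨ half+half ε ⟩
        ε ∎
      where
      open ℚ.≤-Reasoning
      rearrange : ∀ a b c d →
        (a ℚ.+ b) ℚ.- (c ℚ.+ d) ≡ (a ℚ.- c) ℚ.+ (b ℚ.- d)
      rearrange a b c d = trans (cong ((a ℚ.+ b) ℚ.+_) (ℚ.neg-distrib-+ c d))
                                (interchange a b (ℚ.- c) (ℚ.- d))

  bounded : ∀ x → Cauchy x →
    ∃[ B ] (Positive B × ∃[ k ] ∀ i → k ℕ.≤ i → ∣ x i ∣ ℚ.≤ B)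
  bounded x cx with k , p ← cx 1ℚ (ℚ.positive⁻¹ 1ℚ)
    = 1ℚ ℚ.+ ∣ x k ∣
    , ℚ.pos+nonNeg⇒pos 1ℚ ∣ x k ∣ {{ℚ.∣-∣-nonNeg (x k)}}
    , k , λ i ki → begin
      ∣ x i ∣                         ≡⟨ cong ∣_∣ (split (x i) (x k)) ⟩
      ∣ (x i ℚ.- x k) ℚ.+ x k ∣       ≤⟨ ℚ.∣p+q∣≤∣p∣+∣q∣ (x i ℚ.- x k) (x k) ⟩
      ∣ x i ℚ.- x k ∣ ℚ.+ ∣ x k ∣     ≤⟨ ℚ.+-monoˡ-≤ ∣ x k ∣ (ℚ.<⇒≤ (p i k ki ℕ.≤-refl)) ⟩
      1ℚ ℚ.+ ∣ x k ∣                  ∎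
    where open ℚ.≤-Reasoning

  scaled : ∀ B → Positive B → ∀ ε → 0ℚ ℚ.< ε →
    ∃[ δ ] (0ℚ ℚ.< δ × B ℚ.* δ ≡ ε)
  scaled B posB ε 0<ε = B⁻¹ ℚ.* ε , 0<δ , eq
    where
    instance
      _ = posB
      _ = ℚ.pos⇒nonZero B
    B⁻¹ : ℚ
    B⁻¹ = ℚ.1/ B
    instance
      _ = ℚ.1/pos⇒pos B
    0<δ : 0ℚ ℚ.< B⁻¹ ℚ.* ε
    0<δ = subst (ℚ._< B⁻¹ ℚ.* ε) (ℚ.*-zeroʳ B⁻¹) (ℚ.*-monoʳ-<-pos B⁻¹ 0<ε)
    eq : B ℚ.* (B⁻¹ ℚ.* ε) ≡ ε
    eq = trans (sym (ℚ.*-assoc B B⁻¹ ε))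
           (trans (cong (ℚ._* ε) (ℚ.*-inverseʳ B)) (ℚ.*-identityˡ ε))

  ∣*∣-bound : ∀ {B δ} a b → Positive B → ∣ a ∣ ℚ.≤ B → ∣ b ∣ ℚ.< δ →
    ∣ a ℚ.* b ∣ ℚ.< B ℚ.* δ
  ∣*∣-bound {B} {δ} a b posB a≤B b<δ = begin-strict
    ∣ a ℚ.* b ∣       ≡⟨ ℚ.∣p*q∣≡∣p∣*∣q∣ a b ⟩
    ∣ a ∣ ℚ.* ∣ b ∣   ≤⟨ ℚ.*-monoʳ-≤-nonNeg ∣ b ∣ {{ℚ.∣-∣-nonNeg b}} a≤B ⟩
    B ℚ.* ∣ b ∣       <⟨ ℚ.*-monoʳ-<-pos B {{posB}} b<δ ⟩
    B ℚ.* δ           ∎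
    where open ℚ.≤-Reasoning

  abstract
    *-cauchy : ∀ x y → Cauchy x → Cauchy y → Cauchy (λ i → x i ℚ.* y i)
    *-cauchy x y cx cy ε 0<ε
      with A , posA , k₁ , x≤A ← bounded x cx
         | B , posB , k₂ , y≤B ← bounded y cy
      with α , 0<α , Aα≡ ← scaled A posA (½ ℚ.* ε) (half-pos 0<ε)
         | β , 0<β , Bβ≡ ← scaled B posB (½ ℚ.* ε) (half-pos 0<ε)
      with k₃ , p ← cx β 0<β
         | k₄ , q ← cy α 0<α
      = K , λ i j Ki Kj → begin-strict
        ∣ x i ℚ.* y i ℚ.- x j ℚ.* y j ∣
          ≡⟨ cong ∣_∣ (rearrange (x i) (y i) (x j) (y j)) ⟩
        ∣ x i ℚ.* (y i ℚ.- y j) ℚ.+ y j ℚ.* (x i ℚ.- x j) ∣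
          ≤⟨ ℚ.∣p+q∣≤∣p∣+∣q∣ (x i ℚ.* (y i ℚ.- y j)) (y j ℚ.* (x i ℚ.- x j)) ⟩
        ∣ x i ℚ.* (y i ℚ.- y j) ∣ ℚ.+ ∣ y j ℚ.* (x i ℚ.- x j) ∣
          <⟨ ℚ.+-mono-<
               (∣*∣-bound (x i) (y i ℚ.- y j) posA (x≤A i (K₁ Ki)) (q i j (K₄ Ki) (K₄ Kj)))
               (∣*∣-bound (y j) (x i ℚ.- x j) posB (y≤B j (K₂ Kj)) (p i j (K₃ Ki) (K₃ Kj))) ⟩
        A ℚ.* α ℚ.+ B ℚ.* β
          ≡⟨ cong₂ ℚ._+_ Aα≡ Bβ≡ ⟩
        ½ ℚ.* ε ℚ.+ ½ ℚ.* ε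
          ≡⟨ half+half ε ⟩
        ε ∎
      where
      open ℚ.≤-Reasoning
      K : ℕ
      K = (k₁ ℕ.⊔ k₂) ℕ.⊔ (k₃ ℕ.⊔ k₄)
      K₁₂ : ∀ {i} → K ℕ.≤ i → k₁ ℕ.⊔ k₂ ℕ.≤ i
      K₁₂ = ℕ.m⊔n≤o⇒m≤o (k₁ ℕ.⊔ k₂) (k₃ ℕ.⊔ k₄)
      K₃₄ : ∀ {i} → K ℕ.≤ i → k₃ ℕ.⊔ k₄ ℕ.≤ i
      K₃₄ = ℕ.m⊔n≤o⇒n≤o (k₁ ℕ.⊔ k₂) (k₃ ℕ.⊔ k₄)
      K₁ : ∀ {i} → K ℕ.≤ i → k₁ ℕ.≤ i
      K₁ = ℕ.m⊔n≤o⇒m≤o k₁ k₂ ∘ K₁₂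
      K₂ : ∀ {i} → K ℕ.≤ i → k₂ ℕ.≤ i
      K₂ = ℕ.m⊔n≤o⇒n≤o k₁ k₂ ∘ K₁₂
      K₃ : ∀ {i} → K ℕ.≤ i → k₃ ℕ.≤ i
      K₃ = ℕ.m⊔n≤o⇒m≤o k₃ k₄ ∘ K₃₄
      K₄ : ∀ {i} → K ℕ.≤ i → k₄ ℕ.≤ i
      K₄ = ℕ.m⊔n≤o⇒n≤o k₃ k₄ ∘ K₃₄
      rearrange : ∀ a b c d →
        a ℚ.* b ℚ.- c ℚ.* d ≡ a ℚ.* (b ℚ.- d) ℚ.+ d ℚ.* (a ℚ.- c)
      rearrange a b c d = begin-equality
        a ℚ.* b ℚ.- c ℚ.* d
          ≡⟨ cong (ℚ._- c ℚ.* d) (split (a ℚ.* b) (a ℚ.* d)) ⟩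
        ((a ℚ.* b ℚ.- a ℚ.* d) ℚ.+ a ℚ.* d) ℚ.- c ℚ.* d
          ≡⟨ ℚ.+-assoc (a ℚ.* b ℚ.- a ℚ.* d) (a ℚ.* d) (ℚ.- (c ℚ.* d)) ⟩
        (a ℚ.* b ℚ.- a ℚ.* d) ℚ.+ (a ℚ.* d ℚ.- c ℚ.* d)
          ≡⟨ cong₂ ℚ._+_ (x[y-z]≈xy-xz a b d) ([y-z]x≈yx-zx d a c) ⟨
        a ℚ.* (b ℚ.- d) ℚ.+ (a ℚ.- c) ℚ.* d
          ≡⟨ cong (a ℚ.* (b ℚ.- d) ℚ.+_) (ℚ.*-comm (a ℚ.- c) d) ⟩
        a ℚ.* (b ℚ.- d) ℚ.+ d ℚ.* (a ℚ.- c) ∎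

infixl 6 _+ℝ_
infixl 7 _*ℝ_
infixr 8 _^ℝ_

_+ℝ_ : ℝ → ℝ → ℝ
x +ℝ y = mkℝ (λ i → seq x i ℚ.+ seq y i)
             (+-cauchy (seq x) (seq y) (cauchy x) (cauchy y))

_*ℝ_ : ℝ → ℝ → ℝ
x *ℝ y = mkℝ (λ i → seq x i ℚ.* seq y i)
             (*-cauchy (seq x) (seq y) (cauchy x) (cauchy y))

_^ℝ_ : ℝ → ℕ → ℝ
x ^ℝ zero  = 1ℝ
x ^ℝ suc n = x *ℝ x ^ℝ n

-- 2^ x ≤ N says 2ˣ ≤ N for a real exponent x: 2ˣ is the supremum of 2^(a/b)
-- over the rationals a/b < x, and 2^(a/b) ≤ N means 2ᵃ ≤ Nᵇ when b > 0 and
-- N ≥ 1.  A natural number N ≥ 2ˣ > 0 is at least 1, and then the rationals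
-- a/b < 0 impose no condition.
infix 4 2^_≤_

2^_≤_ : ℝ → ℕ → Set
2^ x ≤ N = 1 ℕ.≤ N ×
  (∀ a b .{{_ : NonZero b}} → fromℚ (+ a ℚ./ b) <ℝ x → 2 ℕ.^ a ℕ.≤ N ℕ.^ b)

data Sgn : Set where
  neg zer pos : Sgn

-- The sign function as a relation, since signs of reals are not computable.
HasSign : ℝ → Sgn → Set
HasSign x neg = x <ℝ 0ℝ
HasSign x zer = x ≈ℝ 0ℝ
HasSign x pos = 0ℝ <ℝ x

-- Polynomials (ℝᵈ)ʳ → ℝ, as finite sums of terms c · ∏ₖₗ (pₖ)ₗ ^ eₖₗ.
-- Exponents may repeat, so a formal polynomial is not unique for its function.

Monomial : ℕ → ℕ → Set
Monomial r d = Vector (Vector ℕ d) r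

Polynomial : ℕ → ℕ → Set
Polynomial r d = List (ℝ × Monomial r d)

module _ {r d : ℕ} where

  degree : Monomial r d → ℕ
  degree e = Vector.foldr ℕ._+_ 0 (λ k → Vector.foldr ℕ._+_ 0 (e k))

  DegreeAtMost : ℕ → Polynomial r d → Set
  DegreeAtMost D = All (λ t → degree (proj₂ t) ℕ.≤ D)

  evalMonomial : Monomial r d → Vector (Vector ℝ d) r → ℝ
  evalMonomial e p =
    Vector.foldr _*ℝ_ 1ℝ λ k → Vector.foldr _*ℝ_ 1ℝ λ l → p k l ^ℝ e k l

  eval : Polynomial r d → Vector (Vector ℝ d) r → ℝ
  eval f p = List.foldr (λ (c , e) s → c *ℝ evalMonomial e p +ℝ s) 0ℝ f

record Hypergraph (r N : ℕ) : Set₁ where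
  field
    Edge    : Subset N → Set
    uniform : ∀ {S} → Edge S → card S ≡ r

open Hypergraph public

range : ∀ {r N} → (Fin r → Fin N) → Subset N
range v = ⋃ (List.tabulate λ k → ⁅ v k ⁆)

record SemiAlgebraic (d D m : ℕ) {r N : ℕ} (H : Hypergraph r N) : Set where
  field
    enumeration : Permutation′ N
    point       : Fin N → Vector ℝ d
    polynomial  : Vector (Polynomial r d) m
    degree≤     : ∀ j → DegreeAtMost D (polynomial j)
    Φ           : Vec Sgn m → Bool
    -- s lists the signs of the polynomials at (p_{i₁}, …, p_{iᵣ}); the edge in
    -- question is the set {v_{i₁}, …, v_{iᵣ}}.
    edge⇔       : ∀ (i : Fin r → Fin N) → i Preserves Fin._<_ ⟶ Fin._<_ →
      ∃[ s ] ((∀ j → HasSign (eval (polynomial j) (point ∘ i)) (lookup s j)) ×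
              (Edge H (range ((enumeration ⟨$⟩ʳ_) ∘ i)) ⇔ Φ s ≡ true))

module _ {r N : ℕ} (H : Hypergraph r N) where

  IsClique : Subset N → Set
  IsClique S = ∀ T → T ⊆ S → card T ≡ r → Edge H T

  IsIndependent : Subset N → Set
  IsIndependent S = ∀ T → T ⊆ S → card T ≡ r → ¬ Edge H T

RamseyProperty : (r d D m n N : ℕ) → Set₁
RamseyProperty r d D m n N = (H : Hypergraph r N) → SemiAlgebraic d D m H →
  (∃[ S ] (card S ≡ n × IsClique H S)) ⊎ (∃[ S ] (card S ≡ n × IsIndependent H S))

-- R is the Ramsey number.  It is a relation because the least N is not
-- computable from this definition; classically it exists by Ramsey's theorem.
IsRamseyNumber : (r d D m n R : ℕ) → Set₁
IsRamseyNumber r d D m n R =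
  RamseyProperty r d D m n R × (∀ N → RamseyProperty r d D m n N → R ℕ.≤ N)

module Submission where

open import Defs
open import Data.Nat.Base using (ℕ; _≤_; _^_; _∸_; ⌊_/2⌋)
open import Data.Product.Base using (_×_; ∃-syntax)

open import Data.Bool.Base using (Bool; true; false; not; if_then_else_)
open import Data.Bool.Properties using (not-¬)
open import Data.Empty using (⊥)
open import Data.Fin.Base as Fin using (Fin; zero; suc; toℕ; fromℕ<)
import Data.Fin.Permutation as Permutation
open import Data.Fin.Properties using (toℕ-injective; toℕ-fromℕ<; toℕ<n)
open import Data.Fin.Subset using (Subset; inside; outside; _∈_; _⊆_; ⁅_⁆; _∪_) renaming (∣_∣ to card)
open import Data.Fin.Subset.Properties using
  (∉⊥; x∈p∪q⁻; x∈p∪q⁺; x∈⁅y⁆⇒x≡y; x∈⁅x⁆; ∪-identityˡ; ∣⊥∣≡0; ∣p∣≤n)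
open import Data.Integer.Base as ℤ using (+<+)
import Data.Integer.Properties as ℤ
open import Data.List.Base using ([]; _∷_)
open import Data.List.Relation.Unary.All using ([]; _∷_)
open import Data.Nat.Base using
  (zero; suc; _+_; _*_; _/_; _%_; _<_; _>_; z≤n; s≤s; NonZero; >-nonZero; ∣_-_∣)
open import Data.Nat.DivMod using
  (/-monoˡ-≤; m/n≤m; m/n*n≤m; m≡m%n+[m/n]*n; m%n<n; m/n≡0⇒m<n)
open import Data.Nat.Properties
import Data.Nat.Solver as ℕ
open import Data.Product.Base using (_,_; proj₁; proj₂)
open import Data.Rational.Base as ℚ using (ℚ; 0ℚ; 1ℚ; ∣_∣; toℚᵘ)
import Data.Rational.Properties as ℚ
open import Data.Rational.Solver using (module +-*-Solver)
open import Data.Rational.Unnormalised.Base as ℚᵘ using (mkℚᵘ; *≡*; *<*)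
import Data.Rational.Unnormalised.Properties as ℚᵘ
open import Data.Sum.Base as Sum using (_⊎_; inj₁; inj₂)
open import Data.Vec.Base using ([]; _∷_; here; there; lookup)
open import Data.Vec.Functional using (Vector)
open import Function.Base using (_∘_; case_of_)
open import Function.Bundles using (_⇔_; mk⇔; Equivalence)
open import Relation.Binary.Core using (_Preserves_⟶_)
open import Relation.Binary.Definitions using (tri<; tri≈; tri>)
open import Relation.Binary.PropositionalEquality
open import Relation.Nullary using (¬_; yes; no; contradiction)
open import Relation.Nullary.Decidable using (does; dec-true; dec-false)

-- Let k = ⌊r/2⌋ - 1.  The vertices are the leaves of a binary tree with m ^ k
-- levels, and two leaves that branch at level l are about base ^ ℒ l apart.
-- The linear form is Σᵢ (-1)^|i-k| base ^ τ i (xᵢ₊₁ - xᵢ) over the first 2k + 1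
-- gaps, so its sign is decided by the gap maximising ℒ (level) + τ i.  The
-- three central exponents τ are equal and largest.  In an interval of a
-- homogeneous set, the largest gap is therefore near an end: otherwise it could
-- be made the middle gap of one tuple and the next gap of another, and these
-- have opposite signs.  Cutting repeatedly at the largest gap yields a comb: a
-- linearly long sequence whose gaps have strictly decreasing (or, mirrored,
-- increasing) levels.  Now write levels in base m: ℒ spreads out levels
-- differing in a higher digit much further, and the differences between
-- consecutive τ lie between the k scales of distance so obtained.  A
-- comb of more than about k m levels must contain, below some level, both a
-- jump at a digit j and a smaller jump, and these produce tuples whose
-- deciding gaps are adjacent, hence of opposite signs.

-- Sums and iterated quotients

Σ< : ℕ → (ℕ → ℕ) → ℕ
Σ< zero    f = 0
Σ< (suc n) f = Σ< n f + f n

Σ<-cong : ∀ n {f g} → (∀ i → i < n → f i ≡ g i) → Σ< n f ≡ Σ< n g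
Σ<-cong zero    h = refl
Σ<-cong (suc n) h = cong₂ _+_ (Σ<-cong n λ i i<n → h i (m<n⇒m<1+n i<n)) (h n ≤-refl)

Σ<-mono : ∀ n {f g} → (∀ i → i < n → f i ≤ g i) → Σ< n f ≤ Σ< n g
Σ<-mono zero    h = z≤n
Σ<-mono (suc n) h = +-mono-≤ (Σ<-mono n λ i i<n → h i (m<n⇒m<1+n i<n)) (h n ≤-refl)

Σ<-const : ∀ n c → Σ< n (λ _ → c) ≡ n * c
Σ<-const zero    c = refl
Σ<-const (suc n) c = trans (+-comm (Σ< n (λ _ → c)) c) (cong (c +_) (Σ<-const n c))

Σ<-bound : ∀ n {f} c → (∀ i → i < n → f i ≤ c) → Σ< n f ≤ n * c
Σ<-bound n c h = ≤-trans (Σ<-mono n h) (≤-reflexive (Σ<-const n c))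

term≤Σ< : ∀ n f {i} → i < n → f i ≤ Σ< n f
term≤Σ< (suc n) f i<1+n with m<1+n⇒m<n∨m≡n i<1+n
... | inj₁ i<n  = m≤n⇒m≤n+o (f n) (term≤Σ< n f i<n)
... | inj₂ refl = m≤n+m (f n) (Σ< n f)

Σ<-+ : ∀ n f g → Σ< n (λ i → f i + g i) ≡ Σ< n f + Σ< n g
Σ<-+ zero    f g = refl
Σ<-+ (suc n) f g =
  trans (cong (_+ (f n + g n)) (Σ<-+ n f g)) (interchange (Σ< n f) (Σ< n g) (f n) (g n))
  where open import Algebra.Properties.CommutativeSemigroup +-commutativeSemigroup

module _ (b : ℕ) .{{_ : NonZero b}} where

  quot : ℕ → ℕ → ℕ
  quot zero    v = v
  quot (suc j) v = quot j v / b

  Near : ℕ → ℕ → ℕ → Set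
  Near j u v = quot j u ≡ quot j v

  quot-mono : ∀ j {u v} → u ≤ v → quot j u ≤ quot j v
  quot-mono zero    u≤v = u≤v
  quot-mono (suc j) u≤v = /-monoˡ-≤ b (quot-mono j u≤v)

  quot≤ : ∀ j v → quot j v ≤ v
  quot≤ zero    v = ≤-refl
  quot≤ (suc j) v = ≤-trans (m/n≤m (quot j v) b) (quot≤ j v)

  quot*^≤ : ∀ j v → quot j v * b ^ j ≤ v
  quot*^≤ zero    v = ≤-reflexive (*-identityʳ v)
  quot*^≤ (suc j) v = begin
    quot j v / b * (b * b ^ j)   ≡⟨ *-assoc (quot j v / b) b (b ^ j) ⟨
    quot j v / b * b * b ^ j     ≤⟨ *-monoˡ-≤ (b ^ j) (m/n*n≤m (quot j v) b) ⟩
    quot j v * b ^ j             ≤⟨ quot*^≤ j v ⟩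
    v                            ∎
    where open ≤-Reasoning

  quot≡0 : ∀ j {v} → v < b ^ j → quot j v ≡ 0
  quot≡0 j {v} v< with quot j v in eq
  ... | zero  = refl
  ... | suc q = contradiction
    (≤-trans (m≤m+n (b ^ j) (q * b ^ j)) (subst (λ z → z * b ^ j ≤ v) eq (quot*^≤ j v)))
    (<⇒≱ v<)

  near-^ : ∀ j {u v} → u < b ^ j → v < b ^ j → Near j u v
  near-^ j u< v< = trans (quot≡0 j u<) (sym (quot≡0 j v<))

  near-suc : ∀ j {u v} → Near j u v → Near (suc j) u v
  near-suc j = cong (_/ b)

  near-+ : ∀ d {j u v} → Near j u v → Near (d + j) u v
  near-+ zero    h = h
  near-+ (suc d) {j} h = near-suc (d + j) (near-+ d h)

  near-≤ : ∀ {i j u v} → i ≤ j → Near i u v → Near j u v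
  near-≤ {i} {j} {u} {v} i≤j h = subst (λ z → Near z u v) (m∸n+n≡m i≤j) (near-+ (j ∸ i) h)

  near-left : ∀ j {u v w} → u ≤ v → v ≤ w → Near j u w → Near j u v
  near-left j u≤v v≤w h =
    ≤-antisym (quot-mono j u≤v) (≤-trans (quot-mono j v≤w) (≤-reflexive (sym h)))

  near-right : ∀ j {u v w} → u ≤ v → v ≤ w → Near j u w → Near j v w
  near-right j u≤v v≤w h = trans (sym (near-left j u≤v v≤w h)) h

  far-< : ∀ j {u v} → u ≤ v → ¬ Near j u v → quot j u < quot j v
  far-< j u≤v h = ≤∧≢⇒< (quot-mono j u≤v) h

  -- Both stage-`j` quotients lie in one block of `b` consecutive numbers beginning at a multiple of
  -- `b`.
  quot-gap<b : ∀ j {u v} → Near (suc j) u v → quot j v < quot j u + b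
  quot-gap<b j {u} {v} h = begin-strict
    y                   ≡⟨ m≡m%n+[m/n]*n y b ⟩
    y % b + y / b * b   ≡⟨ cong (λ z → y % b + z * b) h ⟨
    y % b + x / b * b   <⟨ +-monoˡ-< (x / b * b) (m%n<n y b) ⟩
    b + x / b * b       ≤⟨ +-monoʳ-≤ b (m/n*n≤m x b) ⟩
    b + x               ≡⟨ +-comm b x ⟩
    x + b               ∎
    where
    open ≤-Reasoning
    x y : ℕ
    x = quot j u
    y = quot j v

  -- A hierarchical embedding: two arguments whose quotients first agree at
  -- stage j + 1 are mapped to values about ω j apart.
  embed : (ℕ → ℕ) → ℕ → ℕ → ℕ
  embed ω J v = Σ< J λ i → ω i * quot i v

  module _ (ω : ℕ → ℕ) where

    embed-mono : ∀ J {u v} → u ≤ v → embed ω J u ≤ embed ω J v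
    embed-mono J u≤v = Σ<-mono J λ i _ → *-monoʳ-≤ (ω i) (quot-mono i u≤v)

    -- Every summand is monotone, and the summand at stage `j` alone grows by at least `ω j`.
    embed-far : ∀ J {j u v} → u ≤ v → j < J → ¬ Near j u v →
      embed ω J u + ω j ≤ embed ω J v
    embed-far (suc J) {j} {u} {v} u≤v j<1+J far with m<1+n⇒m<n∨m≡n j<1+J
    ... | inj₁ j<J  = begin
      embed ω J u + ω J * quot J u + ω j     ≡⟨ +-assoc (embed ω J u) _ (ω j) ⟩
      embed ω J u + (ω J * quot J u + ω j)   ≡⟨ cong (embed ω J u +_) (+-comm _ (ω j)) ⟩
      embed ω J u + (ω j + ω J * quot J u)   ≡⟨ +-assoc (embed ω J u) (ω j) _ ⟨
      embed ω J u + ω j + ω J * quot J u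
        ≤⟨ +-mono-≤ (embed-far J u≤v j<J far) (*-monoʳ-≤ (ω J) (quot-mono J u≤v)) ⟩
      embed ω J v + ω J * quot J v           ∎
      where open ≤-Reasoning
    ... | inj₂ refl = begin
      embed ω J u + ω J * quot J u + ω J     ≡⟨ +-assoc (embed ω J u) _ (ω J) ⟩
      embed ω J u + (ω J * quot J u + ω J)   ≡⟨ cong (embed ω J u +_) (+-comm _ (ω J)) ⟩
      embed ω J u + (ω J + ω J * quot J u)   ≡⟨ cong (embed ω J u +_) (*-suc (ω J) (quot J u)) ⟨
      embed ω J u + ω J * suc (quot J u)
        ≤⟨ +-mono-≤ (embed-mono J u≤v) (*-monoʳ-≤ (ω J) (far-< J u≤v far)) ⟩
      embed ω J v + ω J * quot J v           ∎
      where open ≤-Reasoning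

    -- Summands from stage `j` on coincide for `u` and `v`; an earlier one is at most `W * ω i`,
    -- since quotients of `v` do not exceed `v`.
    embed-near : ∀ J {j u v W} → v ≤ W → Near j u v →
      embed ω J v ≤ embed ω J u + W * Σ< j ω
    embed-near zero    v≤W near = z≤n
    embed-near (suc J) {j} {u} {v} {W} v≤W near with <-≤-connex J j
    ... | inj₂ j≤J = begin
      embed ω J v + ω J * quot J v
        ≡⟨ cong (λ z → embed ω J v + ω J * z) (near-≤ j≤J near) ⟨
      embed ω J v + ω J * quot J u
        ≤⟨ +-monoˡ-≤ _ (embed-near J {j} v≤W near) ⟩
      embed ω J u + W * Σ< j ω + ω J * quot J u
        ≡⟨ +-assoc (embed ω J u) _ _ ⟩
      embed ω J u + (W * Σ< j ω + ω J * quot J u)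
        ≡⟨ cong (embed ω J u +_) (+-comm (W * Σ< j ω) _) ⟩
      embed ω J u + (ω J * quot J u + W * Σ< j ω)
        ≡⟨ +-assoc (embed ω J u) _ _ ⟨
      embed ω J u + ω J * quot J u + W * Σ< j ω ∎
      where open ≤-Reasoning
    ... | inj₁ J<j = begin
      embed ω (suc J) v
        ≤⟨ Σ<-mono (suc J) (λ i _ → *-monoʳ-≤ (ω i) (≤-trans (quot≤ i v) v≤W)) ⟩
      Σ< (suc J) (λ i → ω i * W)
        ≤⟨ Σ<-scale (suc J) ⟩
      W * Σ< (suc J) ω
        ≤⟨ *-monoʳ-≤ W (Σ<-≤ J<j) ⟩
      W * Σ< j ω
        ≤⟨ m≤n+m _ _ ⟩
      embed ω (suc J) u + W * Σ< j ω ∎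
      where
      open ≤-Reasoning
      Σ<-scale : ∀ n → Σ< n (λ i → ω i * W) ≤ W * Σ< n ω
      Σ<-scale zero    = z≤n
      Σ<-scale (suc n) = begin
        Σ< n (λ i → ω i * W) + ω n * W ≤⟨ +-mono-≤ (Σ<-scale n) (≤-reflexive (*-comm (ω n) W)) ⟩
        W * Σ< n ω + W * ω n           ≡⟨ *-distribˡ-+ W (Σ< n ω) (ω n) ⟨
        W * (Σ< n ω + ω n)             ∎
      Σ<-≤ : ∀ {m n} → m ≤ n → Σ< m ω ≤ Σ< n ω
      Σ<-≤ {m} {zero}  z≤n = z≤n
      Σ<-≤ {m} {suc n} m≤1+n with m<1+n⇒m<n∨m≡n (s≤s m≤1+n)
      ... | inj₁ m<1+n = m≤n⇒m≤n+o (ω n) (Σ<-≤ (≤-pred m<1+n))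
      ... | inj₂ refl  = ≤-refl

-- Exponents, thresholds and dominating gaps

parity : ℕ → Bool
parity zero    = true
parity (suc n) = not (parity n)

Increasing : ℕ → (ℕ → ℕ) → Set
Increasing n a = ∀ i → i < n → a i < a (suc i)

increasing-< : ∀ {n a} → Increasing n a → ∀ {i j} → i < j → j ≤ n → a i < a j
increasing-< {a = a} inc {i} {suc j} i<1+j 1+j≤n with m<1+n⇒m<n∨m≡n i<1+j
... | inj₁ i<j  = <-trans (increasing-< {a = a} inc i<j (<⇒≤ 1+j≤n)) (inc j 1+j≤n)
... | inj₂ refl = inc j 1+j≤n

increasing-≤ : ∀ {n a} → Increasing n a → ∀ {i j} → i ≤ j → j ≤ n → a i ≤ a j
increasing-≤ inc i≤j j≤n with m≤n⇒m<n∨m≡n i≤j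
... | inj₁ i<j  = <⇒≤ (increasing-< inc i<j j≤n)
... | inj₂ refl = ≤-refl

-- For `α ≤ e` this lists `α + 1` consecutive indices ending at `e`, then consecutive indices from
-- `s`. Gap number `α` of such a tuple is the jump from `e` to `s`.
blocks : ℕ → ℕ → ℕ → ℕ → ℕ
blocks α e s i with i ≤? α
... | yes _ = (e ∸ α) + i
... | no  _ = s + (i ∸ suc α)

blocks-left : ∀ α e s {i} → i ≤ α → blocks α e s i ≡ (e ∸ α) + i
blocks-left α e s {i} i≤α with i ≤? α
... | yes _   = refl
... | no  i≰α = contradiction i≤α i≰α

blocks-right : ∀ α e s {i} → α < i → blocks α e s i ≡ s + (i ∸ suc α)
blocks-right α e s {i} α<i with i ≤? α
... | yes i≤α = contradiction i≤α (<⇒≱ α<i)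
... | no  _   = refl

blocks-end : ∀ {α e s} → α ≤ e → blocks α e s α ≡ e
blocks-end {α} {e} {s} α≤e = trans (blocks-left α e s ≤-refl) (m∸n+n≡m α≤e)

blocks-increasing : ∀ {α e s} → α ≤ e → e < s → ∀ n → Increasing n (blocks α e s)
blocks-increasing {α} {e} {s} α≤e e<s n i _ with <-cmp i α
... | tri< i<α _ _ = begin-strict
  blocks α e s i         ≡⟨ blocks-left α e s (<⇒≤ i<α) ⟩
  (e ∸ α) + i            <⟨ +-monoʳ-< (e ∸ α) (n<1+n i) ⟩
  (e ∸ α) + suc i        ≡⟨ blocks-left α e s i<α ⟨
  blocks α e s (suc i)   ∎
  where open ≤-Reasoning
... | tri≈ _ refl _ = begin-strict
  blocks α e s α         ≡⟨ blocks-end α≤e ⟩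
  e                      <⟨ e<s ⟩
  s                      ≤⟨ m≤m+n s _ ⟩
  s + (suc α ∸ suc α)    ≡⟨ blocks-right α e s (n<1+n α) ⟨
  blocks α e s (suc α)   ∎
  where open ≤-Reasoning
... | tri> _ _ α<i = begin-strict
  blocks α e s i         ≡⟨ blocks-right α e s α<i ⟩
  s + (i ∸ suc α)        <⟨ +-monoʳ-< s (∸-monoˡ-< (n<1+n i) α<i) ⟩
  s + (suc i ∸ suc α)    ≡⟨ blocks-right α e s (m<n⇒m<1+n α<i) ⟨
  blocks α e s (suc i)   ∎
  where open ≤-Reasoning

-- A pigeonhole argument: without equal neighbours, each of the `n` steps costs at least one.
descent : ∀ (f : ℕ → ℕ) n → (∀ i → i < n → f (suc i) ≤ f i) →
  (∃[ i ] (i < n × f (suc i) ≡ f i)) ⊎ (f n + n ≤ f 0)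
descent f zero    _    = inj₂ (≤-reflexive (+-identityʳ (f 0)))
descent f (suc n) step with descent f n (λ i i<n → step i (m<n⇒m<1+n i<n))
... | inj₁ (i , i<n , eq) = inj₁ (i , m<n⇒m<1+n i<n , eq)
... | inj₂ h with m≤n⇒m<n∨m≡n (step n ≤-refl)
...   | inj₂ eq = inj₁ (n , ≤-refl , eq)
...   | inj₁ lt = inj₂ (begin
        f (suc n) + suc n     ≡⟨ +-suc (f (suc n)) n ⟩
        suc (f (suc n)) + n   ≤⟨ +-monoˡ-≤ n lt ⟩
        f n + n               ≤⟨ h ⟩
        f 0                   ∎)
        where open ≤-Reasoning

module Levels (k m : ℕ) .{{_ : NonZero m}} (0<k : 0 < k) where

  W : ℕ
  W = m ^ k

  -- Levels agreeing from stage j + 1 on are embedded closer than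
  -- threshold (1 + j) - threshold j, and levels differing at stage j are
  -- embedded further apart than threshold j.
  threshold spread : ℕ → ℕ
  threshold zero    = 0
  threshold (suc j) = threshold j + suc (W * (spread j + suc (threshold j)))
  spread zero       = 0
  spread (suc j)    = spread j + suc (threshold j)

  spread≡Σ : ∀ j → Σ< j (λ i → suc (threshold i)) ≡ spread j
  spread≡Σ zero    = refl
  spread≡Σ (suc j) = cong (_+ suc (threshold j)) (spread≡Σ j)

  threshold-mono : ∀ {i j} → i ≤ j → threshold i ≤ threshold j
  threshold-mono {i} {zero}  z≤n = ≤-refl
  threshold-mono {i} {suc j} i≤1+j with m≤n⇒m<n∨m≡n i≤1+j
  ... | inj₁ i<1+j = m≤n⇒m≤n+o _ (threshold-mono (≤-pred i<1+j))
  ... | inj₂ refl  = ≤-refl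

  ℒ : ℕ → ℕ
  ℒ = embed m (λ i → suc (threshold i)) k

  ℒ-mono : ∀ {u v} → u ≤ v → ℒ u ≤ ℒ v
  ℒ-mono = embed-mono m (λ i → suc (threshold i)) k

  -- The truncated subtraction gives `k - 1`, `k` and `k + 1` the same offset 0, so that the largest
  -- gap of a tuple decides the sign in any of these three places.
  offset : ℕ → ℕ
  offset i = threshold (∣ i - k ∣ ∸ 1)

  τ : ℕ → ℕ
  τ i = threshold k ∸ offset i

  gaps : ℕ
  gaps = suc (k + k)

  combLength : ℕ
  combLength = suc (k * (k + m)) + gaps

  -- l i is the level of the i-th gap of a tuple.  The gap has length about
  -- base ^ ℒ (l i) and coefficient ± base ^ τ i in the linear form, so d is the
  -- gap that decides the sign.
  Dominates : (ℕ → ℕ) → ℕ → Set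
  Dominates l d = ∀ i → i < gaps → i ≢ d → ℒ (l i) + τ i < ℒ (l d) + τ d

  distance : ∀ {i e} → i + e ≡ k → ∣ i - k ∣ ≡ e
  distance {i} {e} refl = ∣m-m+n∣≡n i e

  offset-left : ∀ {i e} → i + suc e ≡ k → offset i ≡ threshold e
  offset-left {i} {e} eq = cong (λ z → threshold (z ∸ 1)) (distance {i} {suc e} eq)

  τ-left : ∀ {i e} → i + suc e ≡ k → τ i + threshold e ≡ threshold k
  τ-left {i} {e} eq = trans (cong (λ z → threshold k ∸ z + threshold e) (offset-left eq))
    (m∸n+n≡m (threshold-mono (≤-trans (n≤1+n e) (m+n≤o⇒n≤o i (≤-reflexive eq)))))

  τ≤ : ∀ i → τ i ≤ threshold k
  τ≤ i = m∸n≤m (threshold k) (offset i)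

  ℒ-far : ∀ {j u v} → u ≤ v → j < k → ¬ Near m j u v → ℒ u + suc (threshold j) ≤ ℒ v
  ℒ-far = embed-far m (λ i → suc (threshold i)) k

  ℒ-near : ∀ j {u v} → v ≤ W → Near m j u v → ℒ v ≤ ℒ u + W * spread j
  ℒ-near j {u} v≤W near = ≤-trans (embed-near m (λ i → suc (threshold i)) k {j} v≤W near)
    (≤-reflexive (cong (λ z → ℒ u + W * z) (spread≡Σ j)))

  -- Against a later gap, `ℒ` gains `1 + threshold j`, while `τ` can lose only
  -- `offset d = threshold j`. An earlier gap `i` may have a higher level, but agreement at stage
  -- `k - 1 - i` keeps its lead in `ℒ` below `τ d - τ i`.
  dominates-threshold : ∀ {l d j} → d + suc j ≡ k →
    (∀ i → i < d → l d ≤ l i × l i ≤ W × Near m (k ∸ suc i) (l d) (l i)) →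
    (∀ i → d < i → i < gaps → l i ≤ l d × ¬ Near m j (l i) (l d)) →
    Dominates l d
  dominates-threshold {l} {d} {j} d+1+j≡k above below i i< i≢d with <-cmp i d
  ... | tri≈ _ i≡d _ = contradiction i≡d i≢d
  ... | tri> _ _ d<i with l≤ , far ← below i d<i i< = begin-strict
    ℒ (l i) + τ i                             ≤⟨ +-monoʳ-≤ (ℒ (l i)) (τ≤ i) ⟩
    ℒ (l i) + threshold k                     ≡⟨ cong (ℒ (l i) +_) (τ-left d+1+j≡k) ⟨
    ℒ (l i) + (τ d + threshold j)             ≡⟨ cong (ℒ (l i) +_) (+-comm (τ d) _) ⟩
    ℒ (l i) + (threshold j + τ d)             <⟨ +-monoʳ-< (ℒ (l i)) (n<1+n _) ⟩
    ℒ (l i) + (suc (threshold j) + τ d)       ≡⟨ +-assoc (ℒ (l i)) _ (τ d) ⟨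
    ℒ (l i) + suc (threshold j) + τ d         ≤⟨ +-monoˡ-≤ (τ d) (ℒ-far l≤ j<k far) ⟩
    ℒ (l d) + τ d                             ∎
    where
    open ≤-Reasoning
    j<k : j < k
    j<k = m+n≤o⇒n≤o d (≤-reflexive d+1+j≡k)
  ... | tri< i<d _ _ = helper (k ∸ suc i) refl
    where
    i<k : i < k
    i<k = <-≤-trans i<d (m+n≤o⇒m≤o d (≤-reflexive d+1+j≡k))
    i+1+e≡k : ∀ {e} → k ∸ suc i ≡ e → i + suc e ≡ k
    i+1+e≡k eq = trans (+-suc i _) (trans (cong (suc i +_) (sym eq)) (m+[n∸m]≡n i<k))
    j<e : ∀ {e} → k ∸ suc i ≡ e → j < e
    j<e {e} eq = +-cancelˡ-≤ (suc i) (suc j) e (begin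
      suc i + suc j   ≤⟨ +-monoˡ-≤ (suc j) i<d ⟩
      d + suc j       ≡⟨ d+1+j≡k ⟩
      k               ≡⟨ i+1+e≡k eq ⟨
      i + suc e       ≡⟨ +-suc i e ⟩
      suc i + e       ∎)
      where open ≤-Reasoning
    helper : ∀ e → k ∸ suc i ≡ e → ℒ (l i) + τ i < ℒ (l d) + τ d
    helper zero eq = contradiction (j<e eq) λ ()
    helper (suc e) eq with _ , l≤W , near ← above i i<d = begin-strict
      ℒ (l i) + τ i               ≤⟨ +-monoˡ-≤ (τ i) (ℒ-near (suc e) l≤W near′) ⟩
      ℒ (l d) + X + τ i           ≡⟨ +-assoc (ℒ (l d)) X (τ i) ⟩
      ℒ (l d) + (X + τ i)         <⟨ +-monoʳ-< (ℒ (l d)) τ-gap ⟩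
      ℒ (l d) + τ d               ∎
      where
      open ≤-Reasoning
      X : ℕ
      X = W * spread (suc e)
      near′ : Near m (suc e) (l d) (l i)
      near′ = subst (λ z → Near m z (l d) (l i)) eq near
      -- Here `τ d - τ i` is `threshold (suc e) - threshold j`. As `j ≤ e`, this is at least the
      -- last increment of `threshold`, which is `1 + X` by definition.
      τ-gap : X + τ i < τ d
      τ-gap = +-cancelʳ-≤ (threshold j) (suc (X + τ i)) (τ d) (begin
        suc X + τ i + threshold j        ≡⟨ cong (_+ threshold j) (+-comm (suc X) (τ i)) ⟩
        τ i + suc X + threshold j        ≡⟨ +-assoc (τ i) (suc X) _ ⟩
        τ i + (suc X + threshold j)      ≡⟨ cong (τ i +_) (+-comm (suc X) _) ⟩
        τ i + (threshold j + suc X)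
          ≤⟨ +-monoʳ-≤ (τ i) (+-monoˡ-≤ (suc X) (threshold-mono (≤-pred (j<e eq)))) ⟩
        τ i + threshold (suc e)          ≡⟨ τ-left (i+1+e≡k eq) ⟩
        threshold k                      ≡⟨ τ-left d+1+j≡k ⟨
        τ d + threshold j                ∎)

  -- A central gap has the maximal `τ`, and distinct levels differ at stage 0, so `ℒ` separates them
  -- by at least one.
  dominates-top : ∀ {l d} → offset d ≡ 0 → (∀ i → i < gaps → i ≢ d → l i < l d) →
    Dominates l d
  dominates-top {l} {d} off≡0 top i i< i≢d = begin-strict
    ℒ (l i) + τ i           <⟨ +-monoˡ-< (τ i) (≤-trans (≤-reflexive (+-comm 1 _))
                                 (ℒ-far (<⇒≤ li<) 0<k (<⇒≢ li<))) ⟩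
    ℒ (l d) + τ i           ≤⟨ +-monoʳ-≤ (ℒ (l d)) (τ≤ i) ⟩
    ℒ (l d) + threshold k   ≡⟨ cong (λ z → ℒ (l d) + (threshold k ∸ z)) off≡0 ⟨
    ℒ (l d) + τ d           ∎
    where
    open ≤-Reasoning
    li< : l i < l d
    li< = top i i< i≢d

  -- Homogeneity as seen by a comb with `t` gaps: the gap from index `a i` to `a (suc i)` has level
  -- `l (a i)`, whichever index follows. The common colour must be the sign of the deciding gap,
  -- which alternates with its distance from the centre.
  Coloured : Bool → ℕ → (ℕ → ℕ) → Set
  Coloured col t l = ∀ a → Increasing gaps a → a gaps ≤ t →
    ∀ d → d < gaps → Dominates (l ∘ a) d → col ≡ parity ∣ d - k ∣

  module _ {col t l} (coloured : Coloured col t l)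
    (l-decreasing : ∀ {i j} → i < j → j < t → l j < l i)
    (l<W : ∀ {i} → i < t → l i < W)
    where

    private
      -- Of each stretch of `w` indices, the first `k` leave room for the gaps before the deciding
      -- one, and the other `m` feed the pigeonhole argument.
      w : ℕ
      w = k + m

      l-antitone : ∀ {i j} → i ≤ j → j < t → l j ≤ l i
      l-antitone i≤j j<t with m≤n⇒m<n∨m≡n i≤j
      ... | inj₁ i<j  = <⇒≤ (l-decreasing i<j j<t)
      ... | inj₂ refl = ≤-refl

    module _ {S} (S< : S + gaps ≤ t) where

      private
        S<t : ∀ {i} → i ≤ S → i < t
        S<t i≤S = ≤-trans (s≤s i≤S) (≤-trans (m<m+n S (s≤s z≤n)) S<)

        right<t : ∀ {i} → i < gaps → ∀ α → S + (i ∸ suc α) < t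
        right<t {i} i< α = <-≤-trans (+-monoʳ-< S (≤-<-trans (m∸n≤m i (suc α)) i<)) S<

      -- The deciding gap is the jump from `e` to `S`, at distance `suc j` from the centre. Its
      -- level differs at stage `j` from that of `S`, hence from all the lower levels after it.
      blocks-dominates : ∀ {α j e} → α + suc j ≡ k → α ≤ e → e < S →
        (∀ i → i < α → Near m (k ∸ suc i) (l e) (l ((e ∸ α) + i))) →
        ¬ Near m j (l S) (l e) →
        col ≡ parity (suc j)
      blocks-dominates {α} {j} {e} α+1+j≡k α≤e e<S near far =
        trans (coloured a (blocks-increasing α≤e e<S gaps) a≤t α α<gaps dominates)
              (cong parity (distance {α} {suc j} α+1+j≡k))
        where
        a : ℕ → ℕ
        a = blocks α e S
        α<k : α < k
        α<k = <-≤-trans (m<m+n α (s≤s z≤n)) (≤-reflexive α+1+j≡k)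
        α<gaps : α < gaps
        α<gaps = m<n⇒m<1+n (<-≤-trans α<k (m≤m+n k k))
        a≤t : a gaps ≤ t
        a≤t = ≤-trans (≤-reflexive (blocks-right α e S α<gaps))
          (≤-trans (+-monoʳ-≤ S (m∸n≤m gaps (suc α))) S<)
        aα≡e : a α ≡ e
        aα≡e = blocks-end α≤e
        dominates : Dominates (l ∘ a) α
        dominates = dominates-threshold α+1+j≡k above below
          where
          above : ∀ i → i < α →
            l (a α) ≤ l (a i) × l (a i) ≤ W × Near m (k ∸ suc i) (l (a α)) (l (a i))
          above i i<α rewrite aα≡e | blocks-left α e S (<⇒≤ i<α) =
            l-antitone i≤e (S<t (<⇒≤ e<S)) ,
            <⇒≤ (l<W (S<t (≤-trans i≤e (<⇒≤ e<S)))) ,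
            near i i<α
            where
            i≤e : (e ∸ α) + i ≤ e
            i≤e = ≤-trans (+-monoʳ-≤ (e ∸ α) (<⇒≤ i<α)) (≤-reflexive (m∸n+n≡m α≤e))
          below : ∀ i → α < i → i < gaps →
            l (a i) ≤ l (a α) × ¬ Near m j (l (a i)) (l (a α))
          below i α<i i< rewrite aα≡e | blocks-right α e S α<i =
            ≤-trans lS+≤ lS≤ , λ h → far (near-right m j lS+≤ lS≤ h)
            where
            lS≤ : l S ≤ l e
            lS≤ = l-antitone (<⇒≤ e<S) (S<t ≤-refl)
            lS+≤ : l (S + (i ∸ suc α)) ≤ l S
            lS+≤ = l-antitone (m≤m+n S _) (right<t i< α)

      -- If the levels of gaps E, …, S agree from stage j + 1 on but those of
      -- E + w and S differ at stage j, then two of the levels in between agree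
      -- from stage j on, which makes tuples of both colours.
      no-long-run : ∀ j → j ≤ k → ∀ E → E + j * w < S → ¬ Near m j (l S) (l E)
      no-long-run zero    _   E E< near =
        <-irrefl near (l-decreasing (≤-<-trans (m≤m+n E 0) E<) (S<t ≤-refl))
      no-long-run (suc j) j<k E E< near with quot m j (l S) ≟ quot m j (l (E + w))
      ... | yes near′ = no-long-run j (<⇒≤ j<k) (E + w)
              (≤-<-trans (≤-reflexive (+-assoc E w (j * w))) E<) near′
      -- All levels of the run share their quotient at stage `suc j`, so their quotients at stage
      -- `j` differ by less than `m`. Among `m` steps, one must therefore leave the stage-`j`
      -- quotient unchanged.
      ... | no far = case descent f m f-step of λ where
          (inj₂ drop) → <⇒≱ (quot-gap<b m j (in-run {E + k + m} {E + k}
              (m≤m+n (E + k) m) (m≤m+n E k) (<⇒≤ E+k+m<S)))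
            (≤-trans drop (≤-reflexive (cong (quot m j ∘ l) (+-identityʳ (E + k)))))
          (inj₁ (i , i<m , eq)) → bicoloured j refl (E + k + i)
            (m≤m+n (E + k) i)
            (≤-trans (≤-reflexive (sym (+-suc (E + k) i))) (+-monoʳ-≤ (E + k) i<m))
            (subst (λ z → Near m j (l z) (l (E + k + i))) (+-suc (E + k) i) eq)
        where
        f : ℕ → ℕ
        f i = quot m j (l (E + k + i))
        E+w≡ : E + k + m ≡ E + w
        E+w≡ = +-assoc E k m
        E+w<S : E + w < S
        E+w<S = ≤-<-trans (+-monoʳ-≤ E (m≤m+n w (j * w))) E<
        E+k+m<S : E + k + m < S
        E+k+m<S = subst (_< S) (sym E+w≡) E+w<S
        f-step : ∀ i → i < m → f (suc i) ≤ f i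
        f-step i i<m = quot-mono m j (l-antitone (+-monoʳ-≤ (E + k) (n≤1+n i))
          (S<t (≤-trans (+-monoʳ-≤ (E + k) i<m) (<⇒≤ E+k+m<S))))
        in-run : ∀ {x y} → y ≤ x → E ≤ y → x ≤ S → Near m (suc j) (l x) (l y)
        in-run {x} {y} y≤x E≤y x≤S =
          near-left m (suc j) (l-antitone y≤x (S<t x≤S)) (l-antitone E≤y (S<t (≤-trans y≤x x≤S)))
            (near-right m (suc j) (l-antitone x≤S (S<t ≤-refl))
              (l-antitone (≤-trans E≤y y≤x) (S<t x≤S)) near)
        E≤shift : ∀ {α x} i → α ≤ k → E + k ≤ x → E ≤ (x ∸ α) + i
        E≤shift {α} {x} i α≤k E+k≤x = m≤n⇒m≤n+o i (m+n≤o⇒m≤o∸n E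
          (≤-trans (+-monoʳ-≤ E α≤k) E+k≤x))
        shift≤ : ∀ {α x i} → i ≤ α → α ≤ x → (x ∸ α) + i ≤ x
        shift≤ {α} {x} i≤α α≤x =
          ≤-trans (+-monoʳ-≤ (x ∸ α) i≤α) (≤-reflexive (m∸n+n≡m α≤x))
        -- First colour: the jump from `E + w` to `S` goes to distance `suc j` from the centre. For
        -- the gaps before it, agreement at stage `suc j` within the run suffices.
        odd : col ≡ parity (suc j)
        odd = blocks-dominates {k ∸ suc j} {j} {E + w} (m∸n+n≡m j<k)
          (≤-trans α≤k k≤E+w) E+w<S near₁ far
          where
          α≤k : k ∸ suc j ≤ k
          α≤k = m∸n≤m k (suc j)
          E+k≤ : E + k ≤ E + w
          E+k≤ = +-monoʳ-≤ E (m≤m+n k m)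
          k≤E+w : k ≤ E + w
          k≤E+w = ≤-trans (m≤n+m k E) E+k≤
          near₁ : ∀ i → i < k ∸ suc j →
            Near m (k ∸ suc i) (l (E + w)) (l ((E + w ∸ (k ∸ suc j)) + i))
          near₁ i i<α = near-≤ m suc-j≤
            (in-run (shift≤ (<⇒≤ i<α) (≤-trans α≤k k≤E+w)) (E≤shift i α≤k E+k≤) (<⇒≤ E+w<S))
            where
            suc-j≤ : suc j ≤ k ∸ suc i
            suc-j≤ = m+n≤o⇒m≤o∸n (suc j) (≤-trans (≤-reflexive (+-comm (suc j) (suc i)))
              (≤-trans (+-monoˡ-≤ (suc j) i<α) (≤-reflexive (m∸n+n≡m j<k))))
        -- Second colour: the jump from `suc q` to `S` goes one place nearer the centre. The
        -- additional gap before it, leaving `q`, needs agreement at stage `j` itself, which the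
        -- repeated quotient supplies. For `j = 0` a repeated quotient is already a repeated level.
        bicoloured : ∀ j′ → j′ ≡ j → ∀ q → E + k ≤ q → q < E + k + m →
          Near m j (l (suc q)) (l q) → ⊥
        bicoloured zero refl q _ q< eq =
          <-irrefl eq (l-decreasing (n<1+n q) (S<t (≤-trans q< (<⇒≤ E+k+m<S))))
        bicoloured (suc j′) refl q E+k≤q q< eq = not-¬ even odd
          where
          α : ℕ
          α = k ∸ j
          α≤k : α ≤ k
          α≤k = m∸n≤m k j
          E+k≤1+q : E + k ≤ suc q
          E+k≤1+q = m≤n⇒m≤1+n E+k≤q
          k≤1+q : k ≤ suc q
          k≤1+q = ≤-trans (m≤n+m k E) E+k≤1+q
          1+q<S : suc q < S
          1+q<S = ≤-<-trans q< E+k+m<S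
          near₂ : ∀ i → i < α → Near m (k ∸ suc i) (l (suc q)) (l ((suc q ∸ α) + i))
          near₂ i i<α with m≤n⇒m<n∨m≡n i<α
          ... | inj₂ 1+i≡α = subst₂ (λ y z → Near m y (l (suc q)) (l z)) (sym stage) (sym index) eq
            where
            stage : k ∸ suc i ≡ j
            stage = trans (cong (k ∸_) 1+i≡α) (m∸[m∸n]≡n (<⇒≤ j<k))
            index : (suc q ∸ α) + i ≡ q
            index = suc-injective (trans (sym (+-suc _ i))
              (trans (cong ((suc q ∸ α) +_) 1+i≡α) (m∸n+n≡m (≤-trans α≤k k≤1+q))))
          ... | inj₁ 1+i<α = near-≤ m suc-j≤
            (in-run (shift≤ (<⇒≤ i<α) (≤-trans α≤k k≤1+q)) (E≤shift i α≤k E+k≤1+q) (<⇒≤ 1+q<S))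
            where
            suc-j≤ : suc j ≤ k ∸ suc i
            suc-j≤ = m+n≤o⇒m≤o∸n (suc j) (≤-trans (≤-reflexive (cong suc (+-comm j (suc i))))
              (≤-trans (+-monoˡ-≤ j 1+i<α) (≤-reflexive (m∸n+n≡m (<⇒≤ j<k)))))
          far₂ : ¬ Near m j′ (l S) (l (suc q))
          far₂ h = far (near-left m j (l-antitone (<⇒≤ E+w<S) (S<t ≤-refl))
            (l-antitone (≤-trans q< (≤-reflexive E+w≡)) (S<t (<⇒≤ E+w<S)))
            (near-suc m j′ h))
          even : col ≡ parity j
          even = blocks-dominates {α} {j′} {suc q} (m∸n+n≡m (<⇒≤ j<k))
            (≤-trans α≤k k≤1+q) 1+q<S near₂ far₂

    -- All levels are below `m ^ k` and so agree at stage `k`. The run from 0 to `suc (k * w)`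
    -- contradicts `no-long-run`, and `combLength` leaves `gaps` further indices after it.
    decreasing-levels-short : ¬ (combLength ≤ t)
    decreasing-levels-short S< = no-long-run S< k ≤-refl 0 ≤-refl
      (near-^ m k (l<W (S<t ≤-refl)) (l<W (S<t z≤n)))
      where
      S<t : ∀ {i} → i ≤ suc (k * w) → i < t
      S<t i≤S = ≤-trans (s≤s i≤S) (≤-trans (m<m+n (suc (k * w)) (s≤s z≤n)) S<)

-- Combs in binary trees

record IsLevel (l u v : ℕ) : Set where
  constructor _,_
  field
    agree  : Near 2 (suc l) u v
    differ : ¬ Near 2 l u v

open IsLevel

-- The highest binary digit below `M` where the arguments differ; the value at `zero` is a default.
level : ℕ → ℕ → ℕ → ℕ
level zero    u v = 0
level (suc M) u v with quot 2 M u ≟ quot 2 M v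
... | yes _ = level M u v
... | no  _ = M

level-isLevel : ∀ M {u v} → u ≢ v → Near 2 M u v → IsLevel (level M u v) u v
level-isLevel zero    u≢v near = contradiction near u≢v
level-isLevel (suc M) {u} {v} u≢v near with quot 2 M u ≟ quot 2 M v
... | yes near′ = level-isLevel M u≢v near′
... | no  far   = near , far

near⇒level< : ∀ {l j u v} → IsLevel l u v → Near 2 j u v → l < j
near⇒level< {l} {j} (_ , far) near = ≰⇒> λ j≤l → far (near-≤ 2 j≤l near)

far⇒≤level : ∀ {l j u v} → IsLevel l u v → ¬ Near 2 j u v → j ≤ l
far⇒≤level {l} {j} (near , _) far = ≮⇒≥ λ l<j → far (near-≤ 2 l<j near)

change : ∀ (f : ℕ → ℕ) a d → (∃[ p ] (a ≤ p × p < a + d × f p ≢ f (suc p))) ⊎ (f a ≡ f (a + d))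
change f a zero    = inj₂ (cong f (sym (+-identityʳ a)))
change f a (suc d) with change f a d
... | inj₁ (p , a≤p , p< , ne) = inj₁ (p , a≤p , <-trans p< (+-monoʳ-< a (n<1+n d)) , ne)
... | inj₂ eq with f (a + d) ≟ f (suc (a + d))
...   | yes eq′ = inj₂ (trans eq (trans eq′ (cong f (sym (+-suc a d)))))
...   | no  ne  = inj₁ (a + d , m≤m+n a d , +-monoʳ-< a (n<1+n d) , ne)

∣-∣-reflect : ∀ k i → i ≤ k + k → ∣ (k + k ∸ i) - k ∣ ≡ ∣ i - k ∣
∣-∣-reflect k i i≤ = begin
  ∣ (k + k ∸ i) - k ∣               ≡⟨ ∣m+n-m+o∣≡∣n-o∣ i _ k ⟨
  ∣ i + (k + k ∸ i) - (i + k) ∣     ≡⟨ cong₂ ∣_-_∣ (m+[n∸m]≡n i≤) (+-comm i k) ⟩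
  ∣ k + k - (k + i) ∣               ≡⟨ ∣m+n-m+o∣≡∣n-o∣ k k i ⟩
  ∣ k - i ∣                         ≡⟨ ∣-∣-comm k i ⟩
  ∣ i - k ∣                         ∎
  where open ≡-Reasoning

module MonochromaticSets (k m : ℕ) .{{_ : NonZero m}} (0<k : 0 < k) where

  open Levels k m 0<k

  -- V p is the p-th vertex of a homogeneous set with n elements.
  module _ (n : ℕ) (V : ℕ → ℕ)
    (V-increasing : ∀ {p q} → p < q → q < n → V p < V q)
    (V< : ∀ {p} → p < n → V p < 2 ^ W)
    (col : Bool)
    (coloured : ∀ a l → Increasing gaps a → a gaps < n →
      (∀ i → i < gaps → IsLevel (l i) (V (a i)) (V (a (suc i)))) →
      ∀ d → d < gaps → Dominates l d → col ≡ parity ∣ d - k ∣)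
    where

    private
      V-mono : ∀ {p q} → p ≤ q → q < n → V p ≤ V q
      V-mono p≤q q<n with m≤n⇒m<n∨m≡n p≤q
      ... | inj₁ p<q  = <⇒≤ (V-increasing p<q q<n)
      ... | inj₂ refl = ≤-refl

      near-W : ∀ {p q} → p < n → q < n → Near 2 W (V p) (V q)
      near-W p<n q<n = near-^ 2 W (V< p<n) (V< q<n)

    module Cut {a b l} (a<b : a < b) (b<n : b < n) (lev : IsLevel l (V a) (V b)) where

      private
        Q : ℕ → ℕ
        Q = quot 2 l ∘ V

        Q-mono : ∀ {p q} → p ≤ q → q ≤ b → Q p ≤ Q q
        Q-mono p≤q q≤b = quot-mono 2 l (V-mono p≤q (≤-<-trans q≤b b<n))

        -- The ends share their quotient at stage `suc l`, so `Q` takes only two values on the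
        -- interval. Being monotone, it changes exactly once.
        Qb≤ : Q b ≤ suc (Q a)
        Qb≤ = ≤-pred (≤-trans (quot-gap<b 2 l (agree lev)) (≤-reflexive (+-comm (Q a) 2)))

      cut : ∃[ p ] (a ≤ p × p < b × Q p ≢ Q (suc p))
      cut with change Q a (b ∸ a)
      ... | inj₁ (p , a≤p , p< , ne) =
        p , a≤p , ≤-trans p< (≤-reflexive (m+[n∸m]≡n (<⇒≤ a<b))) , ne
      ... | inj₂ eq = contradiction (trans eq (cong Q (m+[n∸m]≡n (<⇒≤ a<b)))) (differ lev)

      module _ {p} (a≤p : a ≤ p) (p<b : p < b) (ne : Q p ≢ Q (suc p)) where

        private
          Qp< : Q p < Q (suc p)
          Qp< = ≤∧≢⇒< (Q-mono (n≤1+n p) p<b) ne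

        left-side : ∀ {x} → a ≤ x → x ≤ p → Q x ≡ Q a
        left-side a≤x x≤p = ≤-antisym
          (≤-pred (≤-trans (s≤s (Q-mono x≤p (<⇒≤ p<b))) (≤-trans Qp< (≤-trans (Q-mono p<b ≤-refl) Qb≤))))
          (Q-mono a≤x (≤-trans x≤p (<⇒≤ p<b)))

        right-side : ∀ {x} → p < x → x ≤ b → Q x ≡ Q b
        right-side p<x x≤b = ≤-antisym (Q-mono x≤b ≤-refl)
          (≤-trans Qb≤ (≤-trans (s≤s (Q-mono a≤p (<⇒≤ p<b))) (≤-trans Qp< (Q-mono p<x x≤b))))

        across : ∀ {x y} → a ≤ x → x ≤ p → p < y → y ≤ b → IsLevel l (V x) (V y)
        across a≤x x≤p p<y y≤b =
          near-left 2 (suc l) (V-mono (≤-trans x≤p (<⇒≤ p<y)) (≤-<-trans y≤b b<n)) (V-mono y≤b b<n)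
            (near-right 2 (suc l) (V-mono a≤x (≤-<-trans (≤-trans x≤p (<⇒≤ p<b)) b<n))
              (V-mono (≤-trans x≤p (<⇒≤ p<b)) b<n) (agree lev)) ,
          λ eq → differ lev (trans (sym (left-side a≤x x≤p)) (trans eq (right-side p<y y≤b)))

        -- The gap at p is the largest of the interval; far from both ends, it can
        -- be made the d-th gap of a tuple, which it dominates when d is central.
        window : ∀ d → d < gaps → offset d ≡ 0 → a + d ≤ p → p + gaps ≤ b →
          col ≡ parity ∣ d - k ∣
        window d d<gaps off≡0 a+d≤p p+gaps≤b =
          coloured c l′ (λ i _ → +-monoʳ-< (p ∸ d) (n<1+n i)) (≤-<-trans (c≤b gaps ≤-refl) b<n)
            isLevel d d<gaps (dominates-top off≡0 top)
          where
          c l′ : ℕ → ℕ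
          c i = (p ∸ d) + i
          l′ i = level W (V (c i)) (V (c (suc i)))
          d≤p : d ≤ p
          d≤p = m+n≤o⇒n≤o a a+d≤p
          cd≡p : c d ≡ p
          cd≡p = m∸n+n≡m d≤p
          c≤b : ∀ i → i ≤ gaps → c i ≤ b
          c≤b i i≤ = ≤-trans (+-mono-≤ (m∸n≤m p d) i≤) p+gaps≤b
          a≤c : ∀ i → a ≤ c i
          a≤c i = m≤n⇒m≤n+o i (m+n≤o⇒m≤o∸n a a+d≤p)
          isLevel : ∀ i → i < gaps → IsLevel (l′ i) (V (c i)) (V (c (suc i)))
          isLevel i i< = level-isLevel W (<⇒≢ (V-increasing ci< c<n))
            (near-W (<-trans ci< c<n) c<n)
            where
            ci< : c i < c (suc i)
            ci< = +-monoʳ-< (p ∸ d) (n<1+n i)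
            c<n : c (suc i) < n
            c<n = ≤-<-trans (c≤b (suc i) i<) b<n
          l≤top : l ≤ l′ d
          l≤top = far⇒≤level (isLevel d d<gaps) (subst₂ (λ x y → Q x ≢ Q y) (sym cd≡p)
            (trans (cong suc (sym cd≡p)) (sym (+-suc (p ∸ d) d))) ne)
          top : ∀ i → i < gaps → i ≢ d → l′ i < l′ d
          top i i< i≢d = <-≤-trans (near⇒level< (isLevel i i<) near) l≤top
            where
            near : Q (c i) ≡ Q (c (suc i))
            near with <-cmp i d
            ... | tri≈ _ i≡d _ = contradiction i≡d i≢d
            ... | tri< i<d _ _ = trans (left-side (a≤c i) (≤p (<⇒≤ i<d)))
                                       (sym (left-side (a≤c (suc i)) (≤p i<d)))
              where
              ≤p : ∀ {i} → i ≤ d → c i ≤ p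
              ≤p i≤d = ≤-trans (+-monoʳ-≤ (p ∸ d) i≤d) (≤-reflexive cd≡p)
            ... | tri> _ _ d<i = trans (right-side (p< d<i) (c≤b i (<⇒≤ i<)))
                                       (sym (right-side (p< (m<n⇒m<1+n d<i)) (c≤b (suc i) i<)))
              where
              p< : ∀ {i} → d < i → p < c i
              p< d<i = ≤-<-trans (≤-reflexive (sym cd≡p)) (+-monoʳ-< (p ∸ d) d<i)

        -- Far from both ends, `window` would apply with `d = k` and with `d = suc k`. Both have
        -- offset 0, but they give opposite colours.
        cut-near-end : p ≤ a + k ⊎ b < p + gaps
        cut-near-end with p ≤? a + k | p + gaps ≤? b
        ... | yes p≤ | _       = inj₁ p≤
        ... | no  _  | no  b≱  = inj₂ (≰⇒> b≱)
        ... | no  p≰ | yes ≤b  = contradiction (trans (sym at-k) at-1+k) λ ()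
          where
          at-k : col ≡ true
          at-k = trans (window k (s≤s (m≤m+n k k)) (cong (λ z → threshold (z ∸ 1)) (∣n-n∣≡0 k))
                   (<⇒≤ (≰⇒> p≰)) ≤b)
                   (cong parity (∣n-n∣≡0 k))
          ∣1+k-k∣ : ∣ suc k - k ∣ ≡ 1
          ∣1+k-k∣ = trans (cong (λ z → ∣ z - k ∣) (+-comm 1 k))
            (trans (cong (λ z → ∣ k + 1 - z ∣) (sym (+-identityʳ k))) (∣m+n-m+o∣≡∣n-o∣ k 1 0))
          at-1+k : col ≡ false
          at-1+k = trans (window (suc k) (s≤s (+-monoˡ-≤ k 0<k))
                     (cong (λ z → threshold (z ∸ 1)) ∣1+k-k∣)
                     (≤-trans (≤-reflexive (+-suc a k)) (≰⇒> p≰)) ≤b)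
                     (cong parity ∣1+k-k∣)

    -- A caterpillar subtree with `t + 1` leaves: the level between two teeth depends only on the
    -- earlier one. Taking `_<_` or `_>_` for `_◁_` covers both orientations.
    record Comb (_◁_ : ℕ → ℕ → Set) (a b t : ℕ) : Set where
      field
        tooth    : ℕ → ℕ
        height   : ℕ → ℕ
        ≤tooth   : ∀ {i} → i ≤ t → a ≤ tooth i
        tooth≤   : ∀ {i} → i ≤ t → tooth i ≤ b
        ordered  : ∀ {i j} → i < j → j ≤ t → tooth i ◁ tooth j
        isLevel  : ∀ {i j} → i < j → j ≤ t → IsLevel (height i) (V (tooth i)) (V (tooth j))
        decrease : ∀ {i j} → i < j → j < t → height j < height i

    open Comb

    trivial : ∀ {_◁_ a b} → a ≤ b → Comb _◁_ a b 0
    trivial {a = a} a≤b = record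
      { tooth    = λ _ → a
      ; height   = λ _ → 0
      ; ≤tooth   = λ _ → ≤-refl
      ; tooth≤   = λ _ → a≤b
      ; ordered  = λ i<j j≤0 → contradiction (≤-trans i<j j≤0) λ ()
      ; isLevel  = λ i<j j≤0 → contradiction (≤-trans i<j j≤0) λ ()
      ; decrease = λ _ ()
      }

    widen : ∀ {_◁_ a b a′ b′ t} → a ≤ a′ → b′ ≤ b → Comb _◁_ a′ b′ t → Comb _◁_ a b t
    widen a≤a′ b′≤b C = record
      { Comb C
      ; ≤tooth = λ i≤t → ≤-trans a≤a′ (≤tooth C i≤t)
      ; tooth≤ = λ i≤t → ≤-trans (tooth≤ C i≤t) b′≤b
      }

    -- The remaining points agree with one another at stage `l`, which forces all later heights
    -- below `l`.
    prepend : ∀ {_◁_ a b a′ b′ t z l} → a ≤ a′ → b′ ≤ b → a ≤ z → z ≤ b →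
      (∀ {x} → a′ ≤ x → x ≤ b′ → z ◁ x × IsLevel l (V z) (V x)) →
      (∀ {x y} → a′ ≤ x → x ≤ b′ → a′ ≤ y → y ≤ b′ → Near 2 l (V x) (V y)) →
      Comb _◁_ a′ b′ t → Comb _◁_ a b (suc t)
    prepend {_◁_} {a} {b} {t = t} {z} {l} a≤a′ b′≤b a≤z z≤b first near C = record
      { tooth    = tooth′
      ; height   = height′
      ; ≤tooth   = ≤tooth′
      ; tooth≤   = tooth≤′
      ; ordered  = ordered′
      ; isLevel  = isLevel′
      ; decrease = decrease′
      }
      where
      tooth′ height′ : ℕ → ℕ
      tooth′ zero     = z
      tooth′ (suc i)  = tooth C i
      height′ zero    = l
      height′ (suc i) = height C i
      ≤tooth′ : ∀ {i} → i ≤ suc t → a ≤ tooth′ i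
      ≤tooth′ {zero}  _         = a≤z
      ≤tooth′ {suc i} (s≤s i≤t) = ≤-trans a≤a′ (≤tooth C i≤t)
      tooth≤′ : ∀ {i} → i ≤ suc t → tooth′ i ≤ b
      tooth≤′ {zero}  _         = z≤b
      tooth≤′ {suc i} (s≤s i≤t) = ≤-trans (tooth≤ C i≤t) b′≤b
      ordered′ : ∀ {i j} → i < j → j ≤ suc t → tooth′ i ◁ tooth′ j
      ordered′ {zero}  {suc j} _         (s≤s j≤t) = proj₁ (first (≤tooth C j≤t) (tooth≤ C j≤t))
      ordered′ {suc i} {suc j} (s≤s i<j) (s≤s j≤t) = ordered C i<j j≤t
      isLevel′ : ∀ {i j} → i < j → j ≤ suc t → IsLevel (height′ i) (V (tooth′ i)) (V (tooth′ j))
      isLevel′ {zero}  {suc j} _         (s≤s j≤t) = proj₂ (first (≤tooth C j≤t) (tooth≤ C j≤t))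
      isLevel′ {suc i} {suc j} (s≤s i<j) (s≤s j≤t) = isLevel C i<j j≤t
      decrease′ : ∀ {i j} → i < j → j < suc t → height′ j < height′ i
      decrease′ {zero}  {suc j} _         (s≤s j<t) =
        near⇒level< (isLevel C (n<1+n j) j<t)
          (near (≤tooth C (<⇒≤ j<t)) (tooth≤ C (<⇒≤ j<t)) (≤tooth C j<t) (tooth≤ C j<t))
      decrease′ {suc i} {suc j} (s≤s i<j) (s≤s j<t) = decrease C i<j j<t

    IsLevel-sym : ∀ {l u v} → IsLevel l u v → IsLevel l v u
    IsLevel-sym (near , far) = sym near , far ∘ sym

    -- The largest gap is close to an end. That end becomes a tooth, and the comb continues on the
    -- other side of the cut.
    split : ∀ {a b} → a < b → b < n →
      (∃[ p ] (a ≤ p × p ≤ a + k × (∀ {t} → Comb _<_ (suc p) b t → Comb _<_ a b (suc t)))) ⊎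
      (∃[ p ] (p < b × b < p + gaps × (∀ {u} → Comb _>_ a p u → Comb _>_ a b (suc u))))
    split {a} {b} a<b b<n = Sum.map
        (λ p≤ → p , a≤p , p≤ ,
          prepend (m≤n⇒m≤1+n a≤p) ≤-refl ≤-refl (<⇒≤ a<b)
            (λ p<x x≤b → ≤-<-trans a≤p p<x , across a≤p p<b ne ≤-refl a≤p p<x x≤b)
            (λ p<x x≤b p<y y≤b →
              trans (right-side a≤p p<b ne p<x x≤b) (sym (right-side a≤p p<b ne p<y y≤b))))
        (λ b< → p , p<b , b< ,
          prepend ≤-refl (<⇒≤ p<b) (<⇒≤ a<b) ≤-refl
            (λ a≤x x≤p → ≤-<-trans x≤p p<b , IsLevel-sym (across a≤p p<b ne a≤x x≤p p<b ≤-refl))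
            (λ a≤x x≤p a≤y y≤p →
              trans (left-side a≤p p<b ne a≤x x≤p) (sym (left-side a≤p p<b ne a≤y y≤p))))
        (cut-near-end a≤p p<b ne)
      where
      open Cut {l = level W (V a) (V b)} a<b b<n
        (level-isLevel W (<⇒≢ (V-increasing a<b b<n)) (near-W (<-trans a<b b<n) b<n))
      p : ℕ
      p = proj₁ cut
      a≤p : a ≤ p
      a≤p = proj₁ (proj₂ cut)
      p<b : p < b
      p<b = proj₁ (proj₂ (proj₂ cut))
      ne : quot 2 (level W (V a) (V b)) (V p) ≢ quot 2 (level W (V a) (V b)) (V (suc p))
      ne = proj₂ (proj₂ (proj₂ cut))

    -- Each `split` spends at most `gaps` indices and adds a tooth to one of the two combs.
    comb : ∀ t u a b → a + (t + u) * gaps ≤ b → b < n → Comb _<_ a b t ⊎ Comb _>_ a b u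
    comb zero    u       a b len b<n = inj₁ (trivial (m+n≤o⇒m≤o a len))
    comb (suc t) zero    a b len b<n = inj₂ (trivial (m+n≤o⇒m≤o a len))
    comb (suc t) (suc u) a b len b<n with split (<-≤-trans (m<m+n a (s≤s z≤n)) len) b<n
    ... | inj₁ (p , a≤p , p≤ , extend) = case comb t (suc u) (suc p) b len′ b<n of λ where
        (inj₁ C) → inj₁ (extend C)
        (inj₂ C) → inj₂ (widen (m≤n⇒m≤1+n a≤p) ≤-refl C)
      where
      len′ : suc p + (t + suc u) * gaps ≤ b
      len′ = begin
        suc p + (t + suc u) * gaps       ≤⟨ +-monoˡ-≤ _ (s≤s p≤) ⟩
        suc (a + k) + (t + suc u) * gaps ≡⟨ cong (_+ (t + suc u) * gaps) (+-suc a k) ⟨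
        a + suc k + (t + suc u) * gaps   ≤⟨ +-monoˡ-≤ _ (+-monoʳ-≤ a (s≤s (m≤m+n k k))) ⟩
        a + gaps + (t + suc u) * gaps    ≡⟨ +-assoc a gaps _ ⟩
        a + (suc t + suc u) * gaps       ≤⟨ len ⟩
        b                                ∎
        where open ≤-Reasoning
    ... | inj₂ (p , p<b , b< , extend) = case comb (suc t) u a p len′ (<-trans p<b b<n) of λ where
        (inj₁ C) → inj₁ (widen ≤-refl (<⇒≤ p<b) C)
        (inj₂ C) → inj₂ (extend C)
      where
      len′ : a + (suc t + u) * gaps ≤ p
      len′ = +-cancelʳ-≤ gaps _ p (begin
        a + (suc t + u) * gaps + gaps    ≡⟨ +-assoc a _ gaps ⟩
        a + ((suc t + u) * gaps + gaps)  ≡⟨ cong (a +_) (+-comm _ gaps) ⟩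
        a + suc (suc t + u) * gaps       ≡⟨ cong (λ z → a + z * gaps) (+-suc (suc t) u) ⟨
        a + (suc t + suc u) * gaps       ≤⟨ len ⟩
        b                                ≤⟨ <⇒≤ b< ⟩
        p + gaps                         ∎)
        where open ≤-Reasoning

    height< : ∀ {_◁_ a b t} → b < n → (C : Comb _◁_ a b t) → ∀ {i} → i < t → height C i < W
    height< b<n C i<t = near⇒level< (isLevel C (n<1+n _) i<t)
      (near-W (≤-<-trans (tooth≤ C (<⇒≤ i<t)) b<n) (≤-<-trans (tooth≤ C i<t) b<n))

    left-coloured : ∀ {a b t} → b < n → (C : Comb _<_ a b t) → Coloured col t (height C)
    left-coloured b<n C c c-inc c≤t = coloured (tooth C ∘ c) (height C ∘ c)
      (λ i i< → ordered C (c-inc i i<) (≤t i<))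
      (≤-<-trans (tooth≤ C c≤t) b<n)
      (λ i i< → isLevel C (c-inc i i<) (≤t i<))
      where
      ≤t : ∀ {i} → i < gaps → c (suc i) ≤ _
      ≤t i< = ≤-trans (increasing-≤ c-inc i< ≤-refl) c≤t

    -- Reading the teeth backwards gives an increasing tuple and sends gap `i` to `k + k ∸ i`. Both
    -- `τ` and the parity depend only on the distance from `k`, so domination and colour survive.
    right-coloured : ∀ {a b t} → b < n → (C : Comb _>_ a b t) → Coloured col t (height C)
    right-coloured {t = t} b<n C c c-inc c≤t d d< dom =
      trans (coloured (tooth C ∘ c ∘ (gaps ∸_)) (height C ∘ c ∘ (k + k ∸_)) increasing
              (≤-<-trans (tooth≤ C (c≤ (m∸n≤m gaps gaps))) b<n) levels (k + k ∸ d) (s≤s (m∸n≤m _ d)) dom′)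
            (cong parity (∣-∣-reflect k d (≤-pred d<)))
      where
      c≤ : ∀ {i} → i ≤ gaps → c i ≤ t
      c≤ i≤ = ≤-trans (increasing-≤ c-inc i≤ ≤-refl) c≤t
      step : ∀ i → i < gaps → c (k + k ∸ i) < c (gaps ∸ i)
      step i i< = increasing-< c-inc (≤-reflexive (sym (+-∸-assoc 1 (≤-pred i<)))) (m∸n≤m gaps i)
      increasing : Increasing gaps (tooth C ∘ c ∘ (gaps ∸_))
      increasing i i< = ordered C (step i i<) (c≤ (m∸n≤m gaps i))
      levels : ∀ i → i < gaps → IsLevel (height C (c (k + k ∸ i)))
        (V (tooth C (c (gaps ∸ i)))) (V (tooth C (c (gaps ∸ suc i))))
      levels i i< = IsLevel-sym (isLevel C (step i i<) (c≤ (m∸n≤m gaps i)))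
      τ-reflect : ∀ i → i < gaps → τ (k + k ∸ i) ≡ τ i
      τ-reflect i i< = cong (λ z → threshold k ∸ threshold (z ∸ 1)) (∣-∣-reflect k i (≤-pred i<))
      dom′ : Dominates (height C ∘ c ∘ (k + k ∸_)) (k + k ∸ d)
      dom′ i i< i≢ = subst₂ (λ x y → ℒ (height C (c i′)) + x < ℒ (height C (c y)) + τ (k + k ∸ d))
        (τ-reflect i i<) (sym (m∸[m∸n]≡n (≤-pred d<)))
        (subst (λ y → ℒ (height C (c i′)) + τ i′ < ℒ (height C (c d)) + y) (sym (τ-reflect d d<))
          (dom i′ (s≤s (m∸n≤m _ i)) λ i′≡d →
            i≢ (trans (sym (m∸[m∸n]≡n (≤-pred i<))) (cong (k + k ∸_) i′≡d))))
        where
        i′ : ℕ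
        i′ = k + k ∸ i

    monochromatic-small : n ≤ (combLength + combLength) * gaps
    monochromatic-small = ≮⇒≥ λ big → case comb combLength combLength 0 _ ≤-refl big of λ where
      (inj₁ C) → decreasing-levels-short (left-coloured big C) (decrease C) (height< big C) ≤-refl
      (inj₂ C) → decreasing-levels-short (right-coloured big C) (decrease C) (height< big C) ≤-refl

-- The point configuration and the linear form

-- The linear form with coefficient `c i - c′ i` on the gap `p (suc i) - p i` is
-- `form n c c′ p - form n c′ c p`. Keeping its halves apart avoids negative numbers.
form : ℕ → (c c′ p : ℕ → ℕ) → ℕ
form n c c′ p = Σ< n λ i → c i * p (suc i) + c′ i * p i

form-cong : ∀ n (c c′ : ℕ → ℕ) {p q : ℕ → ℕ} → (∀ i → i ≤ n → p i ≡ q i) → form n c c′ p ≡ form n c c′ q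
form-cong n c c′ h =
  Σ<-cong n λ i i<n → cong₂ (λ x y → c i * x + c′ i * y) (h (suc i) i<n) (h i (<⇒≤ i<n))

-- The first sum is symmetric in `c` and `c′`, so it cancels when the two halves are compared.
form-gaps : ∀ n (c c′ p g : ℕ → ℕ) → (∀ i → i < n → p (suc i) ≡ p i + g i) →
  form n c c′ p ≡ Σ< n (λ i → c i * p i + c′ i * p i) + Σ< n (λ i → c i * g i)
form-gaps n c c′ p g step = trans
  (Σ<-cong n λ i i<n → begin
    c i * p (suc i) + c′ i * p i           ≡⟨ cong (λ z → c i * z + c′ i * p i) (step i i<n) ⟩
    c i * (p i + g i) + c′ i * p i         ≡⟨ cong (_+ c′ i * p i) (*-distribˡ-+ (c i) (p i) (g i)) ⟩
    c i * p i + c i * g i + c′ i * p i     ≡⟨ +-assoc (c i * p i) _ _ ⟩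
    c i * p i + (c i * g i + c′ i * p i)   ≡⟨ cong (c i * p i +_) (+-comm (c i * g i) _) ⟩
    c i * p i + (c′ i * p i + c i * g i)   ≡⟨ +-assoc (c i * p i) _ _ ⟨
    c i * p i + c′ i * p i + c i * g i     ∎)
  (Σ<-+ n (λ i → c i * p i + c′ i * p i) (λ i → c i * g i))
  where open ≡-Reasoning

form-< : ∀ n (c c′ p g : ℕ → ℕ) → (∀ i → i < n → p (suc i) ≡ p i + g i) →
  Σ< n (λ i → c′ i * g i) < Σ< n (λ i → c i * g i) →
  form n c′ c p < form n c c′ p
form-< n c c′ p g step lt = begin-strict
  form n c′ c p
    ≡⟨ form-gaps n c′ c p g step ⟩
  Σ< n (λ i → c′ i * p i + c i * p i) + Σ< n (λ i → c′ i * g i)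
    ≡⟨ cong (_+ Σ< n (λ i → c′ i * g i)) (Σ<-cong n λ i _ → +-comm (c′ i * p i) (c i * p i)) ⟩
  Σ< n (λ i → c i * p i + c′ i * p i) + Σ< n (λ i → c′ i * g i)
    <⟨ +-monoʳ-< _ lt ⟩
  Σ< n (λ i → c i * p i + c′ i * p i) + Σ< n (λ i → c i * g i)
    ≡⟨ form-gaps n c c′ p g step ⟨
  form n c c′ p ∎
  where open ≤-Reasoning

module Configuration (k m : ℕ) .{{_ : NonZero m}} (0<k : 0 < k) where

  open Levels k m 0<k

  -- A gap of level `l` has length between `ω l` and `ratio * ω l`. Since `base` exceeds
  -- `gaps * ratio`, a lead of one in the exponent outweighs all the other gaps together.
  ratio base : ℕ
  ratio = 2 ^ W * W
  base  = suc (gaps * ratio)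

  ω : ℕ → ℕ
  ω l = base ^ ℒ l

  position : ℕ → ℕ
  position = embed 2 ω W

  -- Only stages up to `l` contribute to the difference: at most `W` of them, each at most
  -- `2 ^ W * ω l`.
  position-near : ∀ {l u v} → v < 2 ^ W → l < W → Near 2 (suc l) u v →
    position v ≤ position u + ratio * ω l
  position-near {l} {u} {v} v< l<W near = begin
    position v                               ≤⟨ embed-near 2 ω W {suc l} (<⇒≤ v<) near ⟩
    position u + 2 ^ W * Σ< (suc l) ω        ≤⟨ +-monoʳ-≤ (position u) (*-monoʳ-≤ (2 ^ W) Σ≤) ⟩
    position u + 2 ^ W * (W * ω l)           ≡⟨ cong (position u +_) (*-assoc (2 ^ W) W (ω l)) ⟨
    position u + ratio * ω l                 ∎
    where
    open ≤-Reasoning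
    Σ≤ : Σ< (suc l) ω ≤ W * ω l
    Σ≤ = ≤-trans
      (Σ<-bound (suc l) (ω l) λ i i<1+l → ^-monoʳ-≤ base (ℒ-mono (≤-pred i<1+l)))
      (*-monoˡ-≤ (ω l) l<W)

  weight weight⁺ weight⁻ : ℕ → ℕ
  weight i = base ^ τ i
  weight⁺ i = if parity ∣ i - k ∣ then weight i else 0
  weight⁻ i = if parity ∣ i - k ∣ then 0 else weight i

  if≤ˡ : ∀ b x → (if b then x else 0) ≤ x
  if≤ˡ true  x = ≤-refl
  if≤ˡ false x = z≤n

  if≤ʳ : ∀ b x → (if b then 0 else x) ≤ x
  if≤ʳ true  x = z≤n
  if≤ʳ false x = ≤-refl

  positive negative : (ℕ → ℕ) → ℕ
  positive = form gaps weight⁺ weight⁻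
  negative = form gaps weight⁻ weight⁺

  module _ (l g : ℕ → ℕ) {d} (d< : d < gaps) (dom : Dominates l d)
    (g≥ : ∀ i → i < gaps → ω (l i) ≤ g i) (g≤ : ∀ i → i < gaps → g i ≤ ratio * ω (l i))
    where

    private
      top : ℕ
      top = base ^ (ℒ (l d) + τ d)

    -- The term at `d` already contributes `top` on the right. On the left, each of the `gaps` terms
    -- times `base` is at most `ratio * top`.
    dominated-sum : ∀ (c c′ : ℕ → ℕ) → c d ≡ weight d → c′ d ≡ 0 → (∀ i → c′ i ≤ weight i) →
      Σ< gaps (λ i → c′ i * g i) < Σ< gaps (λ i → c i * g i)
    dominated-sum c c′ c≡ c′≡0 c′≤ = <-≤-trans small large
      where
      open ≤-Reasoning
      small-term : ∀ i → i < gaps → base * (c′ i * g i) ≤ ratio * top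
      small-term i i< with i ≟ d
      ... | yes refl = begin
        base * (c′ d * g d)   ≡⟨ cong (λ z → base * (z * g d)) c′≡0 ⟩
        base * 0              ≡⟨ *-zeroʳ base ⟩
        0                     ≤⟨ z≤n ⟩
        ratio * top           ∎
      ... | no i≢d = begin
        base * (c′ i * g i)
          ≤⟨ *-monoʳ-≤ base (*-mono-≤ (c′≤ i) (g≤ i i<)) ⟩
        base * (base ^ τ i * (ratio * base ^ ℒ (l i)))
          ≡⟨ cong (base *_) (x∙yz≈y∙zx (base ^ τ i) ratio (base ^ ℒ (l i))) ⟩
        base * (ratio * (base ^ ℒ (l i) * base ^ τ i))
          ≡⟨ x∙yz≈y∙xz base ratio (base ^ ℒ (l i) * base ^ τ i) ⟩
        ratio * (base * (base ^ ℒ (l i) * base ^ τ i))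
          ≡⟨ cong (λ z → ratio * (base * z)) (^-distribˡ-+-* base (ℒ (l i)) (τ i)) ⟨
        ratio * base ^ suc (ℒ (l i) + τ i)
          ≤⟨ *-monoʳ-≤ ratio (^-monoʳ-≤ base (dom i i< i≢d)) ⟩
        ratio * top ∎
        where open import Algebra.Properties.CommutativeSemigroup *-commutativeSemigroup
      Σ<-*ˡ : ∀ n f → Σ< n (λ i → base * f i) ≡ base * Σ< n f
      Σ<-*ˡ zero    f = sym (*-zeroʳ base)
      Σ<-*ˡ (suc n) f = trans (cong (_+ base * f n) (Σ<-*ˡ n f)) (sym (*-distribˡ-+ base (Σ< n f) (f n)))
      small : Σ< gaps (λ i → c′ i * g i) < top
      small = *-cancelˡ-< base _ _ (begin-strict
        base * Σ< gaps (λ i → c′ i * g i)     ≡⟨ Σ<-*ˡ gaps (λ i → c′ i * g i) ⟨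
        Σ< gaps (λ i → base * (c′ i * g i))   ≤⟨ Σ<-bound gaps (ratio * top) small-term ⟩
        gaps * (ratio * top)                  ≡⟨ *-assoc gaps ratio top ⟨
        gaps * ratio * top                    <⟨ *-monoˡ-< top {{m^n≢0 base (ℒ (l d) + τ d)}} (n<1+n (gaps * ratio)) ⟩
        base * top                            ∎)
      large : top ≤ Σ< gaps (λ i → c i * g i)
      large = begin
        top                               ≡⟨ ^-distribˡ-+-* base (ℒ (l d)) (τ d) ⟩
        ω (l d) * weight d                ≡⟨ *-comm (ω (l d)) (weight d) ⟩
        weight d * ω (l d)                ≤⟨ *-monoʳ-≤ (weight d) (g≥ d d<) ⟩
        weight d * g d                    ≡⟨ cong (_* g d) c≡ ⟨
        c d * g d                         ≤⟨ term≤Σ< gaps (λ i → c i * g i) d< ⟩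
        Σ< gaps (λ i → c i * g i)         ∎

  module _ (p l : ℕ → ℕ) (far : ∀ i → i < gaps → p i + ω (l i) ≤ p (suc i))
    (near : ∀ i → i < gaps → p (suc i) ≤ p i + ratio * ω (l i)) where

    private
      gap : ℕ → ℕ
      gap i = p (suc i) ∸ p i
      step : ∀ i → i < gaps → p (suc i) ≡ p i + gap i
      step i i< = sym (m+[n∸m]≡n (m+n≤o⇒m≤o (p i) (far i i<)))
      gap≥ : ∀ i → i < gaps → ω (l i) ≤ gap i
      gap≥ i i< = m+n≤o⇒m≤o∸n (ω (l i)) (≤-trans (≤-reflexive (+-comm (ω (l i)) (p i))) (far i i<))
      gap≤ : ∀ i → i < gaps → gap i ≤ ratio * ω (l i)
      gap≤ i i< = m≤n+o⇒m∸n≤o (p (suc i)) (p i) (near i i<)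

    -- The weight of the dominating gap lies wholly in the half of the form that its parity selects,
    -- and that half is the larger.
    dominating-sign : ∀ {d} → d < gaps → Dominates l d →
      does (negative p <? positive p) ≡ parity ∣ d - k ∣
    dominating-sign {d} d< dom with parity ∣ d - k ∣ in eq
    ... | true  = dec-true (negative p <? positive p) (form-< gaps weight⁺ weight⁻ p gap step
      (dominated-sum l gap d< dom gap≥ gap≤ weight⁺ weight⁻
        (cong (λ b → if b then weight d else 0) eq)
        (cong (λ b → if b then 0 else weight d) eq) λ i → if≤ʳ (parity ∣ i - k ∣) (weight i)))
    ... | false = dec-false (negative p <? positive p)
      (<-asym (form-< gaps weight⁻ weight⁺ p gap step
        (dominated-sum l gap d< dom gap≥ gap≤ weight⁻ weight⁺
          (cong (λ b → if b then 0 else weight d) eq)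
          (cong (λ b → if b then weight d else 0) eq) λ i → if≤ˡ (parity ∣ i - k ∣) (weight i))))

-- Integer points and linear polynomials

open import Data.Integer.Base using (+_)

ι : ℕ → ℚ
ι n = + n ℚ./ 1

toℚᵘ-/ : ∀ p q .{{_ : NonZero q}} → toℚᵘ (p ℚ./ q) ℚᵘ.≃ (p ℚᵘ./ q)
toℚᵘ-/ p (suc q) = ℚ.toℚᵘ-fromℚᵘ (mkℚᵘ p q)

ι-+ : ∀ a b → ι (a + b) ≡ ι a ℚ.+ ι b
ι-+ a b = ℚ.toℚᵘ-injective (begin-equality
  toℚᵘ (ι (a + b))                    ≃⟨ toℚᵘ-/ (+ (a + b)) 1 ⟩
  mkℚᵘ (+ (a + b)) 0                  ≃⟨ *≡* (cong (λ z → z ℤ.* + 1) numerators) ⟩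
  mkℚᵘ (+ a) 0 ℚᵘ.+ mkℚᵘ (+ b) 0      ≃⟨ ℚᵘ.+-cong (toℚᵘ-/ (+ a) 1) (toℚᵘ-/ (+ b) 1) ⟨
  toℚᵘ (ι a) ℚᵘ.+ toℚᵘ (ι b)          ≃⟨ ℚ.toℚᵘ-homo-+ (ι a) (ι b) ⟨
  toℚᵘ (ι a ℚ.+ ι b)                  ∎)
  where
  open ℚᵘ.≤-Reasoning
  numerators : + (a + b) ≡ + a ℤ.* + 1 ℤ.+ + b ℤ.* + 1
  numerators = trans (ℤ.pos-+ a b)
    (sym (cong₂ ℤ._+_ (ℤ.*-identityʳ (+ a)) (ℤ.*-identityʳ (+ b))))

ι-* : ∀ a b → ι (a * b) ≡ ι a ℚ.* ι b
ι-* a b = ℚ.toℚᵘ-injective (begin-equality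
  toℚᵘ (ι (a * b))                    ≃⟨ toℚᵘ-/ (+ (a * b)) 1 ⟩
  mkℚᵘ (+ (a * b)) 0                  ≃⟨ *≡* (cong (λ z → z ℤ.* + 1) (ℤ.pos-* a b)) ⟩
  mkℚᵘ (+ a) 0 ℚᵘ.* mkℚᵘ (+ b) 0      ≃⟨ ℚᵘ.*-cong (toℚᵘ-/ (+ a) 1) (toℚᵘ-/ (+ b) 1) ⟨
  toℚᵘ (ι a) ℚᵘ.* toℚᵘ (ι b)          ≃⟨ ℚ.toℚᵘ-homo-* (ι a) (ι b) ⟨
  toℚᵘ (ι a ℚ.* ι b)                  ∎)
  where open ℚᵘ.≤-Reasoning

ι-< : ∀ {a b} → a < b → ι a ℚ.< ι b
ι-< {a} {b} a<b = ℚ.toℚᵘ-cancel-< (begin-strict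
  toℚᵘ (ι a)       ≃⟨ toℚᵘ-/ (+ a) 1 ⟩
  mkℚᵘ (+ a) 0     <⟨ *<* (ℤ.*-monoʳ-<-pos (+ 1) (+<+ a<b)) ⟩
  mkℚᵘ (+ b) 0     ≃⟨ toℚᵘ-/ (+ b) 1 ⟨
  toℚᵘ (ι b)       ∎)
  where open ℚᵘ.≤-Reasoning

nth : ∀ {r} → (Fin r → ℕ) → ℕ → ℕ
nth {zero}  x j       = 0
nth {suc r} x zero    = x zero
nth {suc r} x (suc j) = nth (x ∘ suc) j

nth-≡ : ∀ {r} (x : Fin r → ℕ) (p : ℕ → ℕ) → (∀ i → x i ≡ p (toℕ i)) →
  ∀ {j} → j < r → nth x j ≡ p j
nth-≡ {suc r} x p h {zero}  _         = h zero
nth-≡ {suc r} x p h {suc j} (s≤s j<r) = nth-≡ (x ∘ suc) (p ∘ suc) (h ∘ suc) j<r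

nth-cong : ∀ {r} {x y : Fin r → ℕ} → (∀ i → x i ≡ y i) → ∀ j → nth x j ≡ nth y j
nth-cong {zero}  h j       = refl
nth-cong {suc r} h zero    = h zero
nth-cong {suc r} h (suc j) = nth-cong (h ∘ suc) j

unit : ∀ {r} → ℕ → Monomial r 1
unit zero    zero    _ = 1
unit zero    (suc i) _ = 0
unit (suc j) zero    _ = 0
unit (suc j) (suc i) _ = unit j i zero

degree-0 : ∀ r → degree {r} {1} (λ _ _ → 0) ≡ 0
degree-0 zero    = refl
degree-0 (suc r) = degree-0 r

-- Equality fails for `j` outside the range of variables, where `unit j` is the constant monomial.
degree-unit : ∀ {r} j → degree {r} {1} (unit j) ≤ 1
degree-unit {zero}  j       = z≤n
degree-unit {suc r} zero    = ≤-reflexive (cong suc (degree-0 r))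
degree-unit {suc r} (suc j) = degree-unit {r} j

points : ∀ {r} → (Fin r → ℕ) → Fin r → Vector ℝ 1
points x i _ = fromℕ (x i)

evalMonomial-0 : ∀ {r} (x : Fin r → ℕ) t → seq (evalMonomial (λ _ _ → 0) (points x)) t ≡ 1ℚ
evalMonomial-0 {zero}  x t = refl
evalMonomial-0 {suc r} x t = trans (ℚ.*-identityˡ _) (evalMonomial-0 (x ∘ suc) t)

evalMonomial-unit : ∀ {r j} (x : Fin r → ℕ) t → j < r →
  seq (evalMonomial (unit j) (points x)) t ≡ ι (nth x j)
evalMonomial-unit {suc r} {zero}  x t _ =
  trans (cong₂ ℚ._*_ (trans (ℚ.*-identityʳ (q ℚ.* 1ℚ)) (ℚ.*-identityʳ q))
      (evalMonomial-0 (x ∘ suc) t))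
    (ℚ.*-identityʳ q)
  where
  q : ℚ
  q = ι (x zero)
evalMonomial-unit {suc r} {suc j} x t (s≤s j<r) =
  trans (ℚ.*-identityˡ _) (evalMonomial-unit (x ∘ suc) t j<r)

module _ {r : ℕ} (c c′ : ℕ → ℕ) where

  -- Both products of each half of the form are separate terms, the second half with a minus sign,
  -- so that the value is the difference of the two halves.
  linear : ℕ → Polynomial r 1
  linear zero    = []
  linear (suc n) =
    (fromℕ (c n) , unit (suc n)) ∷ (fromℕ (c′ n) , unit n) ∷
    (fromℚ (ℚ.- ι (c′ n)) , unit (suc n)) ∷ (fromℚ (ℚ.- ι (c n)) , unit n) ∷
    linear n

  linear-degree : ∀ n → DegreeAtMost 1 (linear n)
  linear-degree zero    = []
  linear-degree (suc n) =
    degree-unit {r} (suc n) ∷ degree-unit {r} n ∷ degree-unit {r} (suc n) ∷ degree-unit {r} n ∷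
    linear-degree n

  eval-linear : ∀ n (x : Fin r → ℕ) t → n < r →
    seq (eval (linear n) (points x)) t ≡ ι (form n c c′ (nth x)) ℚ.- ι (form n c′ c (nth x))
  eval-linear zero    x t _   = refl
  eval-linear (suc n) x t n<r = trans
    (cong₂ (λ u v → ι (c n) ℚ.* u ℚ.+ (ι (c′ n) ℚ.* v ℚ.+ (ℚ.- ι (c′ n) ℚ.* u ℚ.+
        (ℚ.- ι (c n) ℚ.* v ℚ.+ seq (eval (linear n) (points x)) t))))
      (evalMonomial-unit x t n<r) (evalMonomial-unit x t (<-trans (n<1+n n) n<r)))
    (trans (cong (λ z → a ℚ.* u ℚ.+ (b ℚ.* v ℚ.+ (ℚ.- b ℚ.* u ℚ.+ (ℚ.- a ℚ.* v ℚ.+ z))))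
        (eval-linear n x t (<-trans (n<1+n n) n<r)))
      (trans (rearrange a b u v F G) (sym (cong₂ ℚ._-_ (expand c c′) (expand c′ c)))))
    where
    a b u v F G : ℚ
    a = ι (c n)
    b = ι (c′ n)
    u = ι (nth x (suc n))
    v = ι (nth x n)
    F = ι (form n c c′ (nth x))
    G = ι (form n c′ c (nth x))
    expand : ∀ d d′ → ι (form (suc n) d d′ (nth x)) ≡
      ι (form n d d′ (nth x)) ℚ.+ (ι (d n) ℚ.* u ℚ.+ ι (d′ n) ℚ.* v)
    expand d d′ = trans (ι-+ (form n d d′ (nth x)) _) (cong (ι (form n d d′ (nth x)) ℚ.+_)
      (trans (ι-+ (d n * nth x (suc n)) _)
        (cong₂ ℚ._+_ (ι-* (d n) (nth x (suc n))) (ι-* (d′ n) (nth x n)))))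
    rearrange : ∀ a b u v F G →
      a ℚ.* u ℚ.+ (b ℚ.* v ℚ.+ (ℚ.- b ℚ.* u ℚ.+ (ℚ.- a ℚ.* v ℚ.+ (F ℚ.- G)))) ≡
      (F ℚ.+ (a ℚ.* u ℚ.+ b ℚ.* v)) ℚ.- (G ℚ.+ (b ℚ.* u ℚ.+ a ℚ.* v))
    rearrange = solve 6 (λ a b u v F G →
      a :* u :+ (b :* v :+ (:- b :* u :+ (:- a :* v :+ (F :- G)))) :=
      (F :+ (a :* u :+ b :* v)) :- (G :+ (b :* u :+ a :* v))) refl
      where open +-*-Solver

isPos : Sgn → Bool
isPos pos = true
isPos _   = false

-- The real number is a constant sequence with an integer value, so comparing `P` with `N` decides
-- its sign.
sign-of-difference : ∀ {x} P N → (∀ t → seq x t ≡ ι P ℚ.- ι N) →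
  ∃[ s ] (HasSign x s × (N < P ⇔ isPos s ≡ true))
sign-of-difference P N x≡ with <-cmp N P
... | tri< N<P _ _ = pos , (ι P ℚ.- ι N , p-q>0 (ι-< N<P) , 0 , λ t _ →
        ℚ.≤-reflexive (trans (ℚ.+-identityˡ _) (sym (x≡ t)))) , mk⇔ (λ _ → refl) (λ _ → N<P)
  where
  p-q>0 : ∀ {p q} → q ℚ.< p → 0ℚ ℚ.< p ℚ.- q
  p-q>0 {p} {q} q<p = subst (ℚ._< p ℚ.- q) (ℚ.+-inverseʳ q) (ℚ.+-monoˡ-< (ℚ.- q) q<p)
... | tri≈ N≮P refl _ = zer , (λ ε 0<ε → 0 , λ t _ →
        subst (ℚ._< ε) (sym (cong ∣_∣ (trans (cong (ℚ._- 0ℚ) (trans (x≡ t) (ℚ.+-inverseʳ (ι P))))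
          (ℚ.+-inverseʳ 0ℚ)))) 0<ε) , mk⇔ (λ N<P → contradiction N<P N≮P) λ ()
... | tri> N≮P _ P<N = neg , (ι N ℚ.- ι P , q-p>0 (ι-< P<N) , 0 , λ t _ →
        ℚ.≤-reflexive (trans (cong (ℚ._+ (ι N ℚ.- ι P)) (x≡ t)) (cancel (ι P) (ι N)))) ,
        mk⇔ (λ N<P → contradiction N<P N≮P) λ ()
  where
  q-p>0 : ∀ {p q} → p ℚ.< q → 0ℚ ℚ.< q ℚ.- p
  q-p>0 {p} {q} p<q = subst (ℚ._< q ℚ.- p) (ℚ.+-inverseʳ p) (ℚ.+-monoˡ-< (ℚ.- p) p<q)
  cancel : ∀ p q → (p ℚ.- q) ℚ.+ (q ℚ.- p) ≡ 0ℚ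
  cancel = solve 2 (λ p q → (p :- q) :+ (q :- p) := con 0ℚ) refl
    where open +-*-Solver

-- Increasing tuples and finite subsets

Monotone : ∀ {r N} → (Fin r → Fin N) → Set
Monotone i = i Preserves Fin._<_ ⟶ Fin._<_

element : ∀ {N} → Subset N → ℕ → ℕ
element []            p       = 0
element (outside ∷ S) p       = suc (element S p)
element (inside  ∷ S) zero    = 0
element (inside  ∷ S) (suc p) = suc (element S p)

element< : ∀ {N} (S : Subset N) {p} → p < card S → element S p < N
element< (outside ∷ S) p<             = s≤s (element< S p<)
element< (inside  ∷ S) {zero}  _      = s≤s z≤n
element< (inside  ∷ S) {suc p} (s≤s p<) = s≤s (element< S p<)

element-increasing : ∀ {N} (S : Subset N) {p q} → p < q → q < card S → element S p < element S q
element-increasing (outside ∷ S) p<q q<                           = s≤s (element-increasing S p<q q<)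
element-increasing (inside  ∷ S) {zero}  {suc q} _         _        = s≤s z≤n
element-increasing (inside  ∷ S) {suc p} {suc q} (s≤s p<q) (s≤s q<) = s≤s (element-increasing S p<q q<)

element∈ : ∀ {N} (S : Subset N) {p} (p< : p < card S) → fromℕ< (element< S p<) ∈ S
element∈ (outside ∷ S) p<               = there (element∈ S p<)
element∈ (inside  ∷ S) {zero}  _        = here
element∈ (inside  ∷ S) {suc p} (s≤s p<) = there (element∈ S p<)

module _ {N : ℕ} where

  ∈range⁻ : ∀ {r} (i : Fin r → Fin N) {x} → x ∈ range i → ∃[ k ] x ≡ i k
  ∈range⁻ {zero}  i x∈ = contradiction x∈ ∉⊥
  ∈range⁻ {suc r} i x∈ with x∈p∪q⁻ ⁅ i zero ⁆ (range (i ∘ suc)) x∈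
  ... | inj₁ x∈₀ = zero , x∈⁅y⁆⇒x≡y (i zero) x∈₀
  ... | inj₂ x∈₁ with k , eq ← ∈range⁻ (i ∘ suc) x∈₁ = suc k , eq

  ∈range⁺ : ∀ {r} (i : Fin r → Fin N) k → i k ∈ range i
  ∈range⁺ i zero    = x∈p∪q⁺ (inj₁ (x∈⁅x⁆ (i zero)))
  ∈range⁺ i (suc k) = x∈p∪q⁺ {p = ⁅ i zero ⁆} (inj₂ (∈range⁺ (i ∘ suc) k))

  monotone-suc : ∀ {r} {i : Fin (suc r) → Fin N} → Monotone i → Monotone (i ∘ suc)
  monotone-suc mono k<l = mono (s≤s k<l)

  zero-min : ∀ {r} {i : Fin (suc r) → Fin N} → Monotone i → ∀ k → toℕ (i zero) ≤ toℕ (i k)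
  zero-min mono zero    = ≤-refl
  zero-min mono (suc k) = <⇒≤ (mono {zero} {suc k} (s≤s z≤n))

card-⁅⁆∪ : ∀ {N} x (S : Subset N) → ¬ x ∈ S → card (⁅ x ⁆ ∪ S) ≡ suc (card S)
card-⁅⁆∪ zero    (outside ∷ S) _  = cong (suc ∘ card) (∪-identityˡ S)
card-⁅⁆∪ zero    (inside  ∷ S) x∉ = contradiction here x∉
card-⁅⁆∪ (suc x) (outside ∷ S) x∉ = card-⁅⁆∪ x S (x∉ ∘ there)
card-⁅⁆∪ (suc x) (inside  ∷ S) x∉ = cong suc (card-⁅⁆∪ x S (x∉ ∘ there))

module _ {N : ℕ} where

  card-range : ∀ {r} (i : Fin r → Fin N) → Monotone i → card (range i) ≡ r
  card-range {zero}  i mono = ∣⊥∣≡0 N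
  card-range {suc r} i mono = trans
    (card-⁅⁆∪ (i zero) (range (i ∘ suc)) λ i₀∈ → case ∈range⁻ (i ∘ suc) i₀∈ of λ where
      (k , eq) → <⇒≢ (mono {zero} {suc k} (s≤s z≤n)) (cong toℕ eq))
    (cong suc (card-range (i ∘ suc) (monotone-suc mono)))

  -- The first values are both the minimum of the common image; with them removed, the tails again
  -- have equal images.
  same-image : ∀ {r} {i j : Fin r → Fin N} → Monotone i → Monotone j →
    (∀ k → ∃[ l ] i k ≡ j l) → (∀ k → ∃[ l ] j k ≡ i l) → ∀ k → i k ≡ j k
  same-image {suc r} {i} {j} mi mj i⊆j j⊆i = λ where
      zero    → i₀≡j₀
      (suc k) → same-image (monotone-suc mi) (monotone-suc mj)
        (tail mi i₀≡j₀ i⊆j) (tail mj (sym i₀≡j₀) j⊆i) k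
    where
    first : ∀ {i j : Fin (suc r) → Fin N} → Monotone j → (∀ k → ∃[ l ] i k ≡ j l) →
      toℕ (j zero) ≤ toℕ (i zero)
    first mj sub with l , eq ← sub zero = ≤-trans (zero-min mj l) (≤-reflexive (cong toℕ (sym eq)))
    i₀≡j₀ : i zero ≡ j zero
    i₀≡j₀ = toℕ-injective (≤-antisym (first {j} {i} mi j⊆i) (first {i} {j} mj i⊆j))
    tail : ∀ {i j : Fin (suc r) → Fin N} → Monotone i → i zero ≡ j zero →
      (∀ k → ∃[ l ] i k ≡ j l) → ∀ k → ∃[ l ] i (suc k) ≡ j (suc l)
    tail mi eq₀ sub k with sub (suc k)
    ... | suc l , eq = l , eq
    ... | zero  , eq = contradiction (cong toℕ (trans eq₀ (sym eq))) (<⇒≢ (mi {zero} {suc k} (s≤s z≤n)))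

  range-injective : ∀ {r} {i j : Fin r → Fin N} → Monotone i → Monotone j →
    range i ≡ range j → ∀ k → i k ≡ j k
  range-injective {i = i} {j} mi mj eq = same-image mi mj
    (λ k → ∈range⁻ j (subst (i k ∈_) eq (∈range⁺ i k)))
    (λ k → ∈range⁻ i (subst (j k ∈_) (sym eq) (∈range⁺ j k)))

-- The hypergraph and the lower bound

module LinearGraph {r : ℕ} (c c′ : ℕ → ℕ) {n : ℕ} (n<r : n < r) (position : ℕ → ℕ) where

  module _ {N : ℕ} where

    value : (Fin r → Fin N) → ℕ → ℕ
    value i = nth (position ∘ toℕ ∘ i)

    PositiveAt : (Fin r → Fin N) → Set
    PositiveAt i = form n c′ c (value i) < form n c c′ (value i)

    positive-cong : ∀ {i j} → (∀ x → i x ≡ j x) → PositiveAt i → PositiveAt j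
    positive-cong {i} {j} i≗j = subst₂ _<_
      (form-cong n c′ c λ x _ → same x) (form-cong n c c′ λ x _ → same x)
      where
      same : ∀ x → value i x ≡ value j x
      same = nth-cong (cong (position ∘ toℕ) ∘ i≗j)

  -- A set has only one increasing enumeration by `range-injective`, so the sign condition on tuples
  -- is a condition on sets.
  graph : ∀ N → Hypergraph r N
  graph N = record
    { Edge    = λ T → ∃[ i ] (Monotone i × range i ≡ T × PositiveAt i)
    ; uniform = λ { (i , mono , refl , _) → card-range i mono }
    }

  graph-edge : ∀ {N} {i : Fin r → Fin N} → Monotone i → Edge (graph N) (range i) ⇔ PositiveAt i
  graph-edge {N} {i} mono = mk⇔
    (λ (j , mono-j , eq , pos-j) → positive-cong (range-injective mono-j mono eq) pos-j)
    (λ pos-i → i , mono , refl , pos-i)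

  graph-semiAlgebraic : ∀ N → SemiAlgebraic 1 1 1 (graph N)
  graph-semiAlgebraic N = record
    { enumeration = Permutation.id
    ; point       = points (position ∘ toℕ)
    ; polynomial  = λ _ → linear c c′ n
    ; degree≤     = λ _ → linear-degree c c′ n
    ; Φ           = λ s → isPos (lookup s zero)
    ; edge⇔       = λ i mono →
        let s , hasSign , pos⇔ = sign-of-difference (form n c c′ (value i)) (form n c′ c (value i))
              (λ t → eval-linear c c′ n (position ∘ toℕ ∘ i) t n<r)
        in s ∷ [] , (λ { zero → hasSign }) , mk⇔
             (Equivalence.to pos⇔ ∘ Equivalence.to (graph-edge mono))
             (Equivalence.from (graph-edge mono) ∘ Equivalence.from pos⇔)
    }

module Construction (k m : ℕ) .{{_ : NonZero m}} (0<k : 0 < k) {r : ℕ}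
  (gaps<r : suc (k + k) < r) where

  open Levels k m 0<k
  open Configuration k m 0<k
  open MonochromaticSets k m 0<k
  open LinearGraph weight⁺ weight⁻ gaps<r position public

  module _ {N : ℕ} (N≤ : N ≤ 2 ^ W) (S : Subset N) where

    private
      extra : ℕ
      extra = r ∸ suc gaps
      V : ℕ → ℕ
      V = element S

      -- The linear form involves only the first `suc gaps` points of an edge. The others are taken
      -- directly after `a gaps`.
      extend : (ℕ → ℕ) → ℕ → ℕ
      extend a i with i ≤? gaps
      ... | yes _ = a i
      ... | no  _ = a gaps + (i ∸ gaps)

      extend-low : ∀ a {i} → i ≤ gaps → extend a i ≡ a i
      extend-low a {i} i≤ with i ≤? gaps
      ... | yes _  = refl
      ... | no  i≰ = contradiction i≤ i≰

      extend-< : ∀ {a} → Increasing gaps a → ∀ {i j} → i < j → extend a i < extend a j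
      extend-< {a} inc {i} {j} i<j with i ≤? gaps | j ≤? gaps
      ... | yes _  | yes j≤ = increasing-< inc i<j j≤
      ... | yes i≤ | no  j≰ = ≤-<-trans (increasing-≤ inc i≤ ≤-refl)
              (m<m+n (a gaps) (m<n⇒0<n∸m (≰⇒> j≰)))
      ... | no  i≰ | yes j≤ = contradiction (≤-trans (<⇒≤ i<j) j≤) i≰
      ... | no  i≰ | no  j≰ = +-monoʳ-< (a gaps) (∸-monoˡ-< i<j (<⇒≤ (≰⇒> i≰)))

      extend-≤ : ∀ {a} → Increasing gaps a → ∀ {i} → i < r → extend a i ≤ a gaps + extra
      extend-≤ {a} inc {i} i<r with i ≤? gaps
      ... | yes i≤ = m≤n⇒m≤n+o extra (increasing-≤ inc i≤ ≤-refl)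
      ... | no  i≰ = +-monoʳ-≤ (a gaps) (m≤n+o⇒m∸n≤o i gaps
              (≤-pred (≤-trans i<r (≤-reflexive (sym (m+[n∸m]≡n gaps<r))))))

    module Tuple (big : extra ≤ card S) {a} (inc : Increasing gaps a)
      (a< : a gaps < card S ∸ extra) where

      index< : ∀ {i} → i < r → extend a i < card S
      index< i<r = ≤-<-trans (extend-≤ inc i<r)
        (≤-trans (+-monoˡ-≤ extra a<) (≤-reflexive (m∸n+n≡m big)))

      tuple : Fin r → Fin N
      tuple x = fromℕ< (element< S (index< (toℕ<n x)))

      toℕ-tuple : ∀ x → toℕ (tuple x) ≡ V (extend a (toℕ x))
      toℕ-tuple x = toℕ-fromℕ< (element< S (index< (toℕ<n x)))

      tuple-monotone : Monotone tuple
      tuple-monotone {x} {y} x<y = subst₂ _<_ (sym (toℕ-tuple x)) (sym (toℕ-tuple y))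
        (element-increasing S (extend-< inc x<y) (index< (toℕ<n y)))

      tuple⊆ : range tuple ⊆ S
      tuple⊆ x∈ with x , refl ← ∈range⁻ tuple x∈ = element∈ S (index< (toℕ<n x))

      tuple-value : ∀ {j} → j ≤ gaps → value tuple j ≡ position (V (a j))
      tuple-value {j} j≤ = trans
        (nth-≡ (position ∘ toℕ ∘ tuple) (position ∘ V ∘ extend a) (λ x → cong position (toℕ-tuple x))
          (≤-<-trans j≤ gaps<r))
        (cong (position ∘ V) (extend-low a j≤))

      tuple-sign : ∀ {l} → (∀ i → i < gaps → IsLevel (l i) (V (a i)) (V (a (suc i)))) →
        ∀ {d} → d < gaps → Dominates l d →
        does (negative (value tuple) <? positive (value tuple)) ≡ parity ∣ d - k ∣
      tuple-sign {l} levels {d} d< dom = trans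
        (cong₂ (λ x y → does (x <? y))
          (form-cong gaps weight⁻ weight⁺ λ _ → tuple-value)
          (form-cong gaps weight⁺ weight⁻ λ _ → tuple-value))
        (dominating-sign (position ∘ V ∘ a) l
          (λ i i< → embed-far 2 ω W (V≤ i i<) (l<W i i<) (IsLevel.differ (levels i i<)))
          (λ i i< → position-near (V< i<) (l<W i i<) (IsLevel.agree (levels i i<)))
          d< dom)
        where
        a≤card : ∀ {i} → i ≤ gaps → a i < card S
        a≤card i≤ = ≤-<-trans (increasing-≤ inc i≤ ≤-refl) (<-≤-trans a< (m∸n≤m (card S) extra))
        V≤ : ∀ i → i < gaps → V (a i) ≤ V (a (suc i))
        V≤ i i< = <⇒≤ (element-increasing S (inc i i<) (a≤card i<))
        V< : ∀ {i} → i < gaps → V (a (suc i)) < 2 ^ W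
        V< i< = <-≤-trans (element< S (a≤card i<)) N≤
        l<W : ∀ i → i < gaps → l i < W
        l<W i i< = near⇒level< (levels i i<)
          (near-^ 2 W (≤-<-trans (V≤ i i<) (V< i<)) (V< i<))

    homogeneous-small : IsClique (graph N) S ⊎ IsIndependent (graph N) S →
      card S ≤ (combLength + combLength) * gaps + extra
    homogeneous-small homogeneous with extra ≤? card S
    ... | no  small = ≤-trans (<⇒≤ (≰⇒> small)) (m≤n+m extra _)
    ... | yes big   = ≤-trans (≤-reflexive (sym (m∸n+n≡m big)))
        (+-monoˡ-≤ extra (case homogeneous of λ where
          (inj₁ clique) → small true λ inc a< → dec-true (_ <? _)
            (Equivalence.to (graph-edge (Tuple.tuple-monotone big inc a<))
              (clique _ (Tuple.tuple⊆ big inc a<) (card-range _ (Tuple.tuple-monotone big inc a<))))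
          (inj₂ indep) → small false λ inc a< → dec-false (_ <? _) λ pos-tuple →
            indep _ (Tuple.tuple⊆ big inc a<) (card-range _ (Tuple.tuple-monotone big inc a<))
              (Equivalence.from (graph-edge (Tuple.tuple-monotone big inc a<)) pos-tuple)))
      where
      -- The last `extra` elements of `S` are set aside for completing tuples to size `r`.
      n : ℕ
      n = card S ∸ extra
      n≤ : n ≤ card S
      n≤ = m∸n≤m (card S) extra
      small : ∀ col →
        (∀ {a} (inc : Increasing gaps a) (a< : a gaps < n) → let open Tuple big {a} inc a< in
          does (negative (value tuple) <? positive (value tuple)) ≡ col) →
        n ≤ (combLength + combLength) * gaps
      small col same = monochromatic-small n V
        (λ p<q q<n → element-increasing S p<q (<-≤-trans q<n n≤))
        (λ p<n → <-≤-trans (element< S (<-≤-trans p<n n≤)) N≤)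
        col
        λ a l inc a< levels d d< dom →
          trans (sym (same inc a<)) (Tuple.tuple-sign big inc a< levels d< dom)

-- Choice of the constant and the final estimate

^-distribʳ-* : ∀ k a b → (a * b) ^ k ≡ a ^ k * b ^ k
^-distribʳ-* zero    a b = refl
^-distribʳ-* (suc k) a b =
  trans (cong (a * b *_) (^-distribʳ-* k a b)) (interchange a b (a ^ k) (b ^ k))
  where open import Algebra.Properties.CommutativeSemigroup *-commutativeSemigroup

module Bounds (k : ℕ) (0<k : 0 < k) {r : ℕ} (gaps<r : suc (k + k) < r) where

  -- `length₁` is `combLength` for `m = 1`, and in general `combLength` is at most `m * length₁`.
  -- Hence homogeneous sets on at most `2 ^ m ^ k` vertices have fewer than `m * blowup` elements.
  -- The factor 2 in `denominator` absorbs the rounding of `n / blowup`.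
  length₁ blowup denominator : ℕ
  length₁     = suc (k * suc k) + suc (k + k)
  blowup      = (length₁ + length₁) * suc (k + k) + r
  denominator = (2 * blowup) ^ k

  0<blowup : 0 < blowup
  0<blowup = ≤-trans (≤-trans (s≤s z≤n) gaps<r) (m≤n+m r _)

  instance
    blowup-nonZero : NonZero blowup
    blowup-nonZero = >-nonZero 0<blowup
    denominator-nonZero : NonZero denominator
    denominator-nonZero = m^n≢0 (2 * blowup) k {{m*n≢0 2 blowup}}

  module _ {n R} (property : RamseyProperty r 1 1 1 n R) where

    -- Any semi-algebraic hypergraph on `R` vertices will do: its homogeneous set has `n` of them.
    n≤R : n ≤ R
    n≤R with property (graph R) (graph-semiAlgebraic R)
      where open Construction k 1 0<k gaps<r
    ... | inj₁ (S , refl , _) = ∣p∣≤n S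
    ... | inj₂ (S , refl , _) = ∣p∣≤n S

    2^m^k≤R : ∀ m .{{_ : NonZero m}} → m * blowup ≤ n → 2 ^ m ^ k ≤ R
    2^m^k≤R m m*blowup≤n = ≮⇒≥ λ R< → <⇒≱ (<-≤-trans small m*blowup≤n) (n≤ (<⇒≤ R<))
      where
      open Construction k m 0<k gaps<r
      open Levels k m 0<k using (combLength)
      extra : ℕ
      extra = r ∸ suc (suc (k + k))
      n≤ : R ≤ 2 ^ m ^ k → n ≤ (combLength + combLength) * suc (k + k) + extra
      n≤ R≤ with property (graph R) (graph-semiAlgebraic R)
      ... | inj₁ (S , refl , clique) = homogeneous-small R≤ S (inj₁ clique)
      ... | inj₂ (S , refl , indep)  = homogeneous-small R≤ S (inj₂ indep)
      open ≤-Reasoning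
      ≤m* : ∀ x → x ≤ m * x
      ≤m* x = m≤n*m x m
      len≤ : combLength ≤ m * length₁
      len≤ = begin
        suc (k * (k + m)) + suc (k + k)
          ≤⟨ +-mono-≤ (+-mono-≤ (≤m* 1) (*-monoʳ-≤ k (+-monoˡ-≤ m (≤m* k)))) (≤m* (suc (k + k))) ⟩
        m * 1 + k * (m * k + m) + m * suc (k + k)
          ≡⟨ solve 2 (λ m k → m :* con 1 :+ k :* (m :* k :+ m) :+ m :* (con 1 :+ (k :+ k)) :=
               m :* ((con 1 :+ k :* (con 1 :+ k)) :+ (con 1 :+ (k :+ k)))) refl m k ⟩
        m * length₁ ∎
        where open ℕ.+-*-Solver
      small : (combLength + combLength) * suc (k + k) + extra < m * blowup
      small = begin-strict
        (combLength + combLength) * suc (k + k) + extra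
          ≤⟨ +-monoˡ-≤ extra (*-monoˡ-≤ (suc (k + k)) (+-mono-≤ len≤ len≤)) ⟩
        (m * length₁ + m * length₁) * suc (k + k) + extra
          <⟨ +-monoʳ-< _ (<-≤-trans (∸-monoʳ-< (s≤s z≤n) gaps<r) (≤m* r)) ⟩
        (m * length₁ + m * length₁) * suc (k + k) + m * r
          ≡⟨ solve 4 (λ m l g r → (m :* l :+ m :* l) :* g :+ m :* r := m :* ((l :+ l) :* g :+ r))
               refl m length₁ (suc (k + k)) r ⟩
        m * blowup ∎
        where open ℕ.+-*-Solver

    -- For positive `m = n / blowup`, the bound `n ≤ m * (2 * blowup)` gives
    -- `n ^ k ≤ m ^ k * denominator`. Hence `a < m ^ k * b`, and `2^m^k≤R` is raised to the power
    -- `b`.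
    2^a≤R^b : 2 ≤ n → ∀ a b → a * denominator < n ^ k * b → 2 ^ a ≤ R ^ b
    2^a≤R^b 2≤n a b lt = go (n / blowup) refl
      where
      open ≤-Reasoning
      go : ∀ m → n / blowup ≡ m → 2 ^ a ≤ R ^ b
      -- For `n < blowup` the exponent is below 1: `n ^ k ≤ denominator` forces `a < b`, and `2 ≤ R`
      -- is enough.
      go zero eq = begin
        2 ^ a   ≤⟨ ^-monoʳ-≤ 2 (<⇒≤ (*-cancelʳ-< denominator a b a<b)) ⟩
        2 ^ b   ≤⟨ ^-monoˡ-≤ b (≤-trans 2≤n n≤R) ⟩
        R ^ b   ∎
        where
        n≤ : n ≤ 2 * blowup
        n≤ = ≤-trans (<⇒≤ (m/n≡0⇒m<n eq)) (m≤n*m blowup 2)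
        a<b : a * denominator < b * denominator
        a<b = <-≤-trans lt (≤-trans (*-monoˡ-≤ b (^-monoˡ-≤ k n≤)) (≤-reflexive (*-comm denominator b)))
      go m@(suc _) eq = begin
        2 ^ a             ≤⟨ ^-monoʳ-≤ 2 (<⇒≤ (*-cancelʳ-< denominator a (m ^ k * b) a<)) ⟩
        2 ^ (m ^ k * b)   ≡⟨ ^-*-assoc 2 (m ^ k) b ⟨
        (2 ^ m ^ k) ^ b   ≤⟨ ^-monoˡ-≤ b (2^m^k≤R m (subst (λ z → z * blowup ≤ n) eq (m/n*n≤m n blowup))) ⟩
        R ^ b             ∎
        where
        n≤ : n ≤ m * (2 * blowup)
        n≤ = begin
          n                             ≡⟨ m≡m%n+[m/n]*n n blowup ⟩
          n % blowup + n / blowup * blowup ≡⟨ cong (λ z → n % blowup + z * blowup) eq ⟩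
          n % blowup + m * blowup       ≤⟨ +-monoˡ-≤ (m * blowup) (<⇒≤ (m%n<n n blowup)) ⟩
          blowup + m * blowup           ≤⟨ +-monoˡ-≤ (m * blowup) (m≤n*m blowup m) ⟩
          m * blowup + m * blowup       ≡⟨ *-distribˡ-+ m blowup blowup ⟨
          m * (blowup + blowup)         ≡⟨ cong (λ z → m * (blowup + z)) (+-identityʳ blowup) ⟨
          m * (2 * blowup)              ∎
        a< : a * denominator < m ^ k * b * denominator
        a< = begin-strict
          a * denominator               <⟨ lt ⟩
          n ^ k * b                     ≤⟨ *-monoˡ-≤ b (^-monoˡ-≤ k n≤) ⟩
          (m * (2 * blowup)) ^ k * b    ≡⟨ cong (_* b) (^-distribʳ-* k m (2 * blowup)) ⟩
          m ^ k * denominator * b       ≡⟨ xy∙z≈xz∙y (m ^ k) denominator b ⟩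
          m ^ k * b * denominator       ∎
          where open import Algebra.Properties.CommutativeSemigroup *-commutativeSemigroup

2k+2≤r : ∀ r → 4 ≤ r → suc ((⌊ r /2⌋ ∸ 1) + (⌊ r /2⌋ ∸ 1)) < r
2k+2≤r r 4≤r with ⌊ r /2⌋ | ⌊n/2⌋≤⌈n/2⌉ r | ⌊n/2⌋+⌈n/2⌉≡n r
... | zero  | _ | _  = ≤-trans (s≤s (s≤s z≤n)) 4≤r
... | suc h | ≤⌈ | eq = ≤-trans (≤-reflexive (cong suc (sym (+-suc h h))))
  (≤-trans (+-monoʳ-≤ (suc h) ≤⌈) (≤-reflexive eq))

/<⇒*< : ∀ a b d N .{{_ : NonZero b}} .{{_ : NonZero d}} →
  + a ℚ./ b ℚ.< (+ 1 ℚ./ d) ℚ.* ι N → a * d < N * b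
/<⇒*< a b@(suc _) d@(suc _) N lt = subst₂ _<_
  (cong (a *_) (*-identityʳ d)) (cong (_* b) (*-identityˡ N))
  (ℤ.drop‿+<+ (subst₂ ℤ._<_ (sym (ℤ.pos-* a (d * 1)))
    (trans (cong (ℤ._* + b) (sym (ℤ.pos-* 1 N))) (sym (ℤ.pos-* (1 * N) b)))
    (ℚᵘ.drop-*<* cross)))
  where
  open ℚᵘ.≤-Reasoning
  cross : (+ a ℚᵘ./ b) ℚᵘ.< (+ 1 ℚᵘ./ d) ℚᵘ.* mkℚᵘ (+ N) 0
  cross = begin-strict
    + a ℚᵘ./ b                             ≃⟨ toℚᵘ-/ (+ a) b ⟨
    toℚᵘ (+ a ℚ./ b)                       <⟨ ℚ.toℚᵘ-mono-< lt ⟩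
    toℚᵘ ((+ 1 ℚ./ d) ℚ.* ι N)             ≃⟨ ℚ.toℚᵘ-homo-* (+ 1 ℚ./ d) (ι N) ⟩
    toℚᵘ (+ 1 ℚ./ d) ℚᵘ.* toℚᵘ (ι N)       ≃⟨ ℚᵘ.*-cong (toℚᵘ-/ (+ 1) d) (toℚᵘ-/ (+ N) 1) ⟩
    (+ 1 ℚᵘ./ d) ℚᵘ.* mkℚᵘ (+ N) 0         ∎

fromℚ-<⁻ : ∀ {p q} → fromℚ p <ℝ fromℚ q → p ℚ.< q
fromℚ-<⁻ {p} {q} (ε , 0<ε , t , h) = begin-strict
  p              ≡⟨ ℚ.+-identityʳ p ⟨
  p ℚ.+ 0ℚ       <⟨ ℚ.+-monoʳ-< p 0<ε ⟩
  p ℚ.+ ε        ≤⟨ h t ≤-refl ⟩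
  q              ∎
  where open ℚ.≤-Reasoning

fromℚ-<⁺ : ∀ {q} → 0ℚ ℚ.< q → 0ℝ <ℝ fromℚ q
fromℚ-<⁺ {q} 0<q = q , 0<q , 0 , λ _ _ → ℚ.≤-reflexive (ℚ.+-identityˡ q)

theorem4 : (r : ℕ) → 4 ≤ r →
    ∃[ c ] (0ℝ <ℝ c ×
    ((n : ℕ) → 2 ≤ n → (R : ℕ) → IsRamseyNumber r 1 1 1 n R →
    2^ c *ℝ fromℕ (n ^ (⌊ r /2⌋ ∸ 1)) ≤ R))
theorem4 r 4≤r =
  fromℚ (+ 1 ℚ./ denominator) ,
  fromℚ-<⁺ (ℚ.positive⁻¹ (+ 1 ℚ./ denominator) {{ℚ.normalize-pos 1 denominator}}) ,
  λ n 2≤n R (property , _) →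
    ≤-trans (s≤s z≤n) (≤-trans 2≤n (n≤R property)) ,
    λ a b lt → 2^a≤R^b property 2≤n a b
      (/<⇒*< a b denominator (n ^ k) (fromℚ-<⁻ lt))
  where
  k : ℕ
  k = ⌊ r /2⌋ ∸ 1
  0<k : 0 < k
  0<k = ∸-monoˡ-≤ 1 (⌊n/2⌋-mono 4≤r)
  open Bounds k 0<k (2k+2≤r r 4≤r)
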